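{- For $k=-1,0,1,2,\dots$, \[ (D_x+D_y+k)F_{k+1} = (D_xD_y- D_x-D_y+1-k)F_k + \sum_{l=0}^{k+1} D_x F_l \cdot D_y F_{k+1-l}, \] where $D_x = x \partial_x$ and $D_y = y \partial_y$.
   Context: For integers $r,s\ge 0$ and $k$, $N_{\rm bi}(r,s,k)$ is the number of connected bipartite simple graphs with labeled bipartition $V_1\sqcup V_2$, $|V_1|=r$, $|V_2|=s$, having exactly $r+s+k-1$ edges; equivalently, the number of connected spanning subgraphs of the complete bipartite graph $K_{r,s}$ with $r+s+k-1$ edges. In particular $N_{\rm bi}(r,s,k)=0$ if $k<0$ or $r+s+k-1>rs$, with the following conventions: if $rs=0$, then $N_{\rm bi}(r,s,k)=1$ if $k=0$ and $(r,s)\in\{(1,0),(0,1)\}$, and $0$ otherwise. For $k\ge 0$ let $F_k(x,y) = \sum_{r,s=0}^{\infty} \frac{N_{\rm bi}(r,s,k)}{r!s!}x^r y^s$ (formal power series), and let $F_{ -1}:=0$. -}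

module Defs where

open import Data.Bool using (false; true)
open import Data.Empty using (⊥)
open import Data.Fin as Fin using (Fin; toℕ)
open import Data.Fin.Properties as Fin using ()
open import Data.Fin.Subset using (Subset; _∈_; ∣_∣)
open import Data.Fin.Subset.Properties using (_∈?_)
open import Data.Integer as ℤ using (ℤ; +_; -[1+_])
import Data.Integer.Properties as ℤ
open import Data.List as List using (List; []; _∷_; _++_; allFin; length; filter; cartesianProductWith)
open import Data.List.Membership.Propositional using () renaming (_∈_ to _∈ₗ_)
open import Data.List.Membership.Propositional.Properties using (∈-map⁺; ∈-++⁺ˡ; ∈-++⁺ʳ; ∈-allFin)
import Data.List.Properties as List
import Data.List.Relation.Unary.All as All
open import Data.List.Relation.Unary.Any using (here; there)
open import Data.Nat as ℕ using (ℕ; zero; suc; _∸_; _!)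
open import Data.Nat.Properties using (_!*_!≢0)
open import Data.Product using (_×_; _,_)
open import Data.Rational as ℚ using (ℚ; 0ℚ; _/_)
import Data.Rational.Properties as ℚ
open import Data.Sum using (_⊎_; inj₁; inj₂)
open import Data.Vec as Vec using (Vec; []; _∷_; lookup)
open import Function using (_∘_)
open import Relation.Binary.Construct.Closure.ReflexiveTransitive using (Star; ε; _◅_; _◅◅_)
open import Relation.Binary.PropositionalEquality using (_≡_; refl)
open import Relation.Nullary using (Dec; yes; no; ¬_)
open import Relation.Nullary.Decidable using (map′; _×-dec_; _⊎-dec_)

open import Algebra.Properties.Monoid.Sum ℚ.+-0-monoid using (sum-syntax; sum⁺-syntax) public

------------------------------------------------------------------------
-- Bipartite graphs

-- A simple graph with labelled bipartition Fin r ⊔ Fin s, i.e. a spanning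
-- subgraph of K_{r,s}: the i-th entry is the set of neighbours in Fin s of
-- the vertex i of Fin r.
BiGraph : ℕ → ℕ → Set
BiGraph r s = Vec (Subset s) r

Vertex : ℕ → ℕ → Set
Vertex r s = Fin r ⊎ Fin s

edges : ∀ {r s} → BiGraph r s → ℕ
edges G = Vec.sum (Vec.map ∣_∣ G)

Adj : ∀ {r s} → BiGraph r s → Vertex r s → Vertex r s → Set
Adj G (inj₁ i) (inj₂ j) = j ∈ lookup G i
Adj G (inj₂ j) (inj₁ i) = j ∈ lookup G i
Adj G (inj₁ _) (inj₁ _) = ⊥
Adj G (inj₂ _) (inj₂ _) = ⊥

-- The graph without vertices does not count as connected; this is what the
-- value N_bi(0,0,k) = 0 requires.
Connected : ∀ {r s} → BiGraph r s → Set
Connected {r} {s} G = Vertex r s × (∀ u v → Star (Adj G) u v)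

------------------------------------------------------------------------
-- Decidability of connectedness

adj? : ∀ {r s} (G : BiGraph r s) u v → Dec (Adj G u v)
adj? G (inj₁ i) (inj₂ j) = j ∈? lookup G i
adj? G (inj₂ j) (inj₁ i) = j ∈? lookup G i
adj? G (inj₁ _) (inj₁ _) = no λ ()
adj? G (inj₂ _) (inj₂ _) = no λ ()

-- Warshall's algorithm: Via R as u v says that R leads from u to v along a
-- nonempty walk all of whose intermediate vertices lie in as.
module _ {A : Set} (R : A → A → Set) where

  Via : List A → A → A → Set
  Via []       u v = R u v
  Via (a ∷ as) u v = Via as u v ⊎ (Via as u a × Via as a v)

  via? : (∀ u v → Dec (R u v)) → ∀ as u v → Dec (Via as u v)
  via? R? []       u v = R? u v
  via? R? (a ∷ as) u v = via? R? as u v ⊎-dec (via? R? as u a ×-dec via? R? as a v)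

  via⇒star : ∀ as {u v} → Via as u v → Star R u v
  via⇒star []       p              = p ◅ ε
  via⇒star (a ∷ as) (inj₁ p)       = via⇒star as p
  via⇒star (a ∷ as) (inj₂ (p , q)) = via⇒star as p ◅◅ via⇒star as q

  step⇒via : ∀ as {u v} → R u v → Via as u v
  step⇒via []       p = p
  step⇒via (a ∷ as) p = inj₁ (step⇒via as p)

  via-trans : ∀ as {a u v} → a ∈ₗ as → Via as u a → Via as a v → Via as u v
  via-trans (b ∷ as) (here refl) p q = inj₂ (to p , from q)
    where
    to : ∀ {u} → Via (b ∷ as) u b → Via as u b
    to (inj₁ p)       = p
    to (inj₂ (p , _)) = p
    from : ∀ {v} → Via (b ∷ as) b v → Via as b v
    from (inj₁ q)       = q
    from (inj₂ (_ , q)) = q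
  via-trans (b ∷ as) (there m) (inj₁ p)       (inj₁ q)       = inj₁ (via-trans as m p q)
  via-trans (b ∷ as) (there m) (inj₁ p)       (inj₂ (q , t)) = inj₂ (via-trans as m p q , t)
  via-trans (b ∷ as) (there m) (inj₂ (p , q)) (inj₁ t)       = inj₂ (p , via-trans as m q t)
  via-trans (b ∷ as) (there m) (inj₂ (p , _)) (inj₂ (_ , t)) = inj₂ (p , t)

  star⇒via : ∀ as → (∀ a → a ∈ₗ as) → ∀ {u v} → Star R u v → u ≡ v ⊎ Via as u v
  star⇒via as all ε = inj₁ refl
  star⇒via as all (p ◅ ps) with star⇒via as all ps
  ... | inj₁ refl = inj₂ (step⇒via as p)
  ... | inj₂ q    = inj₂ (via-trans as (all _) (step⇒via as p) q)

module _ {r s : ℕ} where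

  vertices : List (Vertex r s)
  vertices = List.map inj₁ (allFin r) ++ List.map inj₂ (allFin s)

  ∈-vertices : ∀ v → v ∈ₗ vertices
  ∈-vertices (inj₁ i) = ∈-++⁺ˡ (∈-map⁺ inj₁ (∈-allFin i))
  ∈-vertices (inj₂ j) = ∈-++⁺ʳ _ (∈-map⁺ inj₂ (∈-allFin j))

  _≟ᵥ_ : (u v : Vertex r s) → Dec (u ≡ v)
  inj₁ i ≟ᵥ inj₁ j = map′ (λ { refl → refl }) (λ { refl → refl }) (i Fin.≟ j)
  inj₂ i ≟ᵥ inj₂ j = map′ (λ { refl → refl }) (λ { refl → refl }) (i Fin.≟ j)
  inj₁ _ ≟ᵥ inj₂ _ = no λ ()
  inj₂ _ ≟ᵥ inj₁ _ = no λ ()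

  nonempty? : Dec (Vertex r s)
  nonempty? = nonempty′? r s
    where
    nonempty′? : ∀ r s → Dec (Vertex r s)
    nonempty′? (suc _) _       = yes (inj₁ Fin.zero)
    nonempty′? zero    (suc _) = yes (inj₂ Fin.zero)
    nonempty′? zero    zero    = no λ { (inj₁ ()) ; (inj₂ ()) }

  reachable? : (G : BiGraph r s) → ∀ u v → Dec (Star (Adj G) u v)
  reachable? G u v =
    map′ (λ { (inj₁ refl) → ε ; (inj₂ p) → via⇒star (Adj G) vertices p })
         (star⇒via (Adj G) vertices ∈-vertices)
         ((u ≟ᵥ v) ⊎-dec via? (Adj G) (adj? G) vertices u v)

  ∀ᵥ? : {P : Vertex r s → Set} → (∀ v → Dec (P v)) → Dec (∀ v → P v)
  ∀ᵥ? P? = map′ (λ { (f , g) (inj₁ i) → f i ; (f , g) (inj₂ j) → g j })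
                (λ h → h ∘ inj₁ , h ∘ inj₂)
                (Fin.all? (P? ∘ inj₁) ×-dec Fin.all? (P? ∘ inj₂))

  connected? : (G : BiGraph r s) → Dec (Connected G)
  connected? G = nonempty? ×-dec ∀ᵥ? (λ u → ∀ᵥ? (reachable? G u))

------------------------------------------------------------------------
-- Counting

vectors : ∀ {A : Set} → List A → ∀ n → List (Vec A n)
vectors xs zero    = [] ∷ []
vectors xs (suc n) = cartesianProductWith _∷_ xs (vectors xs n)

-- Every graph occurs exactly once.
allBiGraphs : ∀ r s → List (BiGraph r s)
allBiGraphs r s = vectors (vectors (false ∷ true ∷ []) s) r

Counted : ∀ {r s} → ℤ → BiGraph r s → Set
Counted {r} {s} k G = Connected G × + edges G ≡ + r ℤ.+ + s ℤ.+ k ℤ.- ℤ.1ℤ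

counted? : ∀ {r s} k (G : BiGraph r s) → Dec (Counted k G)
counted? k G = connected? G ×-dec (_ ℤ.≟ _)

-- No separate clauses are needed for r s = 0: the conventional values are
-- the actual counts (see the Nbi-… lemmas below).
Nbi : ℕ → ℕ → ℤ → ℕ
Nbi r s k = length (filter (counted? k) (allBiGraphs r s))

Nbi-none : ∀ r s k → (∀ (G : BiGraph r s) → ¬ Counted k G) → Nbi r s k ≡ 0
Nbi-none r s k none
  rewrite List.filter-none (counted? k) {xs = allBiGraphs r s} (All.universal none _) = refl

Nbi-1,0 : Nbi 1 0 ℤ.0ℤ ≡ 1
Nbi-1,0 = refl

Nbi-0,1 : Nbi 0 1 ℤ.0ℤ ≡ 1
Nbi-0,1 = refl

Nbi-0,s : ∀ s k → ¬ (s ≡ 1 × k ≡ ℤ.0ℤ) → Nbi 0 s k ≡ 0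
Nbi-0,s s k h = Nbi-none 0 s k (none s h)
  where
  none : ∀ s → ¬ (s ≡ 1 × k ≡ ℤ.0ℤ) → (G : BiGraph 0 s) → ¬ Counted k G
  none 0 h G ((inj₁ () , _) , _)
  none 0 h G ((inj₂ () , _) , _)
  none 1 h [] (_ , e) = h (refl , edgeless k e)
    where
    edgeless : ∀ k → + 0 ≡ + 0 ℤ.+ + 1 ℤ.+ k ℤ.- ℤ.1ℤ → k ≡ ℤ.0ℤ
    edgeless (+ zero) _ = refl
    edgeless (+ suc _) ()
    edgeless -[1+ zero ] ()
    edgeless -[1+ suc _ ] ()
  none (suc (suc s)) h G ((_ , c) , _)
    with c (inj₂ Fin.zero) (inj₂ (Fin.suc Fin.zero))
  ... | _◅_ {j = inj₁ ()} _ _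
  ... | _◅_ {j = inj₂ _} () _

Nbi-r,0 : ∀ r k → ¬ (r ≡ 1 × k ≡ ℤ.0ℤ) → Nbi r 0 k ≡ 0
Nbi-r,0 r k h = Nbi-none r 0 k (none r h)
  where
  none : ∀ r → ¬ (r ≡ 1 × k ≡ ℤ.0ℤ) → (G : BiGraph r 0) → ¬ Counted k G
  none 0 h G ((inj₁ () , _) , _)
  none 0 h G ((inj₂ () , _) , _)
  none 1 h ([] ∷ []) (_ , e) = h (refl , edgeless k e)
    where
    edgeless : ∀ k → + 0 ≡ + 1 ℤ.+ + 0 ℤ.+ k ℤ.- ℤ.1ℤ → k ≡ ℤ.0ℤ
    edgeless (+ zero) _ = refl
    edgeless (+ suc _) ()
    edgeless -[1+ zero ] ()
    edgeless -[1+ suc _ ] ()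
  none (suc (suc r)) h G ((_ , c) , _)
    with c (inj₁ Fin.zero) (inj₁ (Fin.suc Fin.zero))
  ... | _◅_ {j = inj₂ ()} _ _
  ... | _◅_ {j = inj₁ _} () _

------------------------------------------------------------------------
-- Formal power series in x and y over ℚ

-- f r s is the coefficient of xʳyˢ.
Series : Set
Series = ℕ → ℕ → ℚ

infix  4 _≈_
infixl 6 _⊕_ _⊖_
infixl 7 _⊛_ _•_

_≈_ : Series → Series → Set
f ≈ g = ∀ r s → f r s ≡ g r s

0ₛ : Series
0ₛ _ _ = 0ℚ

_⊕_ _⊖_ _⊛_ : Series → Series → Series
(f ⊕ g) r s = f r s ℚ.+ g r s
(f ⊖ g) r s = f r s ℚ.- g r s
(f ⊛ g) r s =
  ∑[ i ≤ r ] ∑[ j ≤ s ] (f (toℕ i) (toℕ j) ℚ.* g (r ∸ toℕ i) (s ∸ toℕ j))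

_•_ : ℤ → Series → Series
(c • f) r s = (c / 1) ℚ.* f r s

∑ₛ : ∀ n → (Fin n → Series) → Series
∑ₛ n f r s = ∑[ l < n ] f l r s

x·_ y·_ ∂x ∂y Dx Dy : Series → Series
(x· f) zero    s = 0ℚ
(x· f) (suc r) s = f r s
(y· f) r zero    = 0ℚ
(y· f) r (suc s) = f r s
∂x f r s = (+ suc r / 1) ℚ.* f (suc r) s
∂y f r s = (+ suc s / 1) ℚ.* f r (suc s)
Dx f = x· (∂x f)
Dy f = y· (∂y f)

-- Only the indices k ≥ -1 are meaningful; F is set to 0 at all negative ones.
F : ℤ → Series
F (+ k)    r s = (+ Nbi r s (+ k) / (r ! ℕ.* s !)) {{r !* s !≢0}}
F -[1+ _ ]     = 0ₛ

{-# OPTIONS --safe #-}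
module Submission where

open import Data.Bool using (Bool; true; false; not; _∧_; _∨_)
import Data.Bool as Bool
open import Data.Empty using (⊥; ⊥-elim)
open import Data.Fin using (Fin; zero; suc; toℕ)
import Data.Fin as Fin
import Data.Fin.Properties as Fin
open import Data.Fin.Subset using (Subset; ∁) renaming (∣_∣ to card)
open import Data.Integer using (ℤ; +_; -[1+_]; -1ℤ; 1ℤ; ∣_∣; _+_; _-_; _≤_)
import Data.Integer as ℤ
import Data.Integer.Properties as ℤ
open import Data.List using (List; []; _∷_; _++_; allFin; map; cartesianProductWith; filter; length)
import Data.List as List
import Data.List.Properties as List
open import Data.Nat using (ℕ; zero; suc; pred; _≡ᵇ_; _!; _∸_; z≤n; s≤s)
import Data.Nat as ℕ
open import Data.Nat.ListAction using (sum)
open import Data.Nat.ListAction.Properties using (sum-++)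
import Data.Nat.Properties as ℕ
import Data.Nat.Solver as ℕ-Solver
open import Data.Product using (_×_; _,_; ∃-syntax; proj₁; proj₂)
open import Data.Rational using (ℚ; 0ℚ; 1ℚ; _/_)
import Data.Rational as ℚ
import Data.Rational.Properties as ℚ
import Data.Rational.Solver as ℚ-Solver
import Data.Rational.Unnormalised as ℚᵘ
import Data.Rational.Unnormalised.Properties as ℚᵘ
open import Data.Sum using (_⊎_; inj₁; inj₂)
import Data.Sum as Sum
import Data.Sum.Properties as Sum
open import Data.Vec using (Vec; []; _∷_; lookup; _[_]%=_; _[_]≔_)
import Data.Vec as Vec
import Data.Vec.Properties as Vec
open import Function using (_∘_; id; mk⇔)
open import Relation.Binary.Construct.Closure.ReflexiveTransitive using (Star; ε; _◅_; _◅◅_)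
import Relation.Binary.Construct.Closure.ReflexiveTransitive as Star
open import Relation.Binary.PropositionalEquality
  using (_≡_; _≢_; refl; sym; trans; cong; cong₂; subst; subst₂; module ≡-Reasoning)
open import Relation.Nullary using (Dec; yes; no; does; ¬_)
open import Relation.Nullary.Decidable using (dec-true; dec-false; does-⇔)
open import Relation.Unary using (Decidable)
open import Algebra.Properties.CommutativeSemigroup ℕ.+-commutativeSemigroup using (interchange)
open import Algebra.Properties.Monoid.Sum ℚ.+-0-monoid using (sum-cong-≗)
open import Defs

open ≡-Reasoning

-- Let uv range over the edges of a connected graph G with n vertices and n - 1 + m
-- edges. Either G - uv is connected, and each connected graph with n - 2 + m edges
-- arises once for each of its non-edges; or G - uv has exactly two components, with
-- vertex sets A ⊔ B ∋ u and ∁A ⊔ ∁B ∋ v, whose excesses add up to m. Counting the pairs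
-- (G , uv) both ways gives the recurrence for N_bi; dividing by r! s! turns the choice
-- of A and B into the product of exponential generating functions.

-- `Dx` and `Dy` multiply the coefficient of x^r y^s by r and s, so the operators can be read as
-- choices. A graph counted by N_bi(r,s,k+1) has r + s + k edges to delete: the left side. One
-- counted by N_bi(r,s,k) has r s - (r + s + k - 1) non-edges: the operator DxDy - Dx - Dy + 1 - k.
-- In the split case u is any of the left vertices in A and v any of the right vertices outside B:
-- the product of a `Dx` and a `Dy`.
--
-- Two obstacles shape the proof. Deleting an edge controls the number of edges, not the excess, so
-- the count is made at a fixed number of edges. Only the inequality vertices ≤ edges + 1 for
-- connected graphs makes every excess nonnegative; it confines l to 0, ..., k + 1, and it settles k
-- = -1, since no connected graph has one edge fewer than a tree. Secondly, the number of non-edges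
-- is a difference, so every identity over ℕ carries the subtracted part on its other side until the
-- passage to ℚ.

private
  variable
    X Y Z W : Set

-- Sums over lists

χ : Bool → ℕ
χ true  = 1
χ false = 0

χ-∧ : ∀ a b → χ (a ∧ b) ≡ χ a ℕ.* χ b
χ-∧ true  b = sym (ℕ.+-identityʳ (χ b))
χ-∧ false b = refl

Sum : List X → (X → ℕ) → ℕ
Sum xs f = sum (map f xs)

infixl 5 Sum
syntax Sum xs (λ x → e) = Σ[ x ∈ xs ] e

Sum-cong : ∀ {f g : X → ℕ} xs → (∀ x → f x ≡ g x) → Sum xs f ≡ Sum xs g
Sum-cong xs h = cong sum (List.map-cong h xs)

Sum-0 : ∀ (xs : List X) {f : X → ℕ} → (∀ x → f x ≡ 0) → Sum xs f ≡ 0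
Sum-0 []       h = refl
Sum-0 (x ∷ xs) h = cong₂ ℕ._+_ (h x) (Sum-0 xs h)

Sum-+ : ∀ (xs : List X) (f g : X → ℕ) →
        (Σ[ x ∈ xs ] f x ℕ.+ g x) ≡ Sum xs f ℕ.+ Sum xs g
Sum-+ []       f g = refl
Sum-+ (x ∷ xs) f g =
  trans (cong (f x ℕ.+ g x ℕ.+_) (Sum-+ xs f g)) (interchange (f x) (g x) _ _)

Sum-*ˡ : ∀ (xs : List X) c (f : X → ℕ) → (Σ[ x ∈ xs ] c ℕ.* f x) ≡ c ℕ.* Sum xs f
Sum-*ˡ []       c f = sym (ℕ.*-zeroʳ c)
Sum-*ˡ (x ∷ xs) c f =
  trans (cong (c ℕ.* f x ℕ.+_) (Sum-*ˡ xs c f)) (sym (ℕ.*-distribˡ-+ c (f x) _))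

Sum-*ʳ : ∀ (xs : List X) c (f : X → ℕ) → (Σ[ x ∈ xs ] f x ℕ.* c) ≡ Sum xs f ℕ.* c
Sum-*ʳ []       c f = refl
Sum-*ʳ (x ∷ xs) c f =
  trans (cong (f x ℕ.* c ℕ.+_) (Sum-*ʳ xs c f)) (sym (ℕ.*-distribʳ-+ c (f x) _))

Sum-χ-∧ : ∀ (xs : List X) a (b : X → Bool) (h : X → ℕ) →
  (Σ[ x ∈ xs ] χ (a ∧ b x) ℕ.* h x) ≡ χ a ℕ.* (Σ[ x ∈ xs ] χ (b x) ℕ.* h x)
Sum-χ-∧ xs a b h = trans
  (Sum-cong xs λ x → trans (cong (ℕ._* h x) (χ-∧ a (b x))) (ℕ.*-assoc (χ a) _ _)) (Sum-*ˡ xs (χ a) _)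

Sum-swap : ∀ (xs : List X) (ys : List Y) (f : X → Y → ℕ) →
           (Σ[ x ∈ xs ] Σ[ y ∈ ys ] f x y) ≡ (Σ[ y ∈ ys ] Σ[ x ∈ xs ] f x y)
Sum-swap []       ys f = sym (Sum-0 ys λ _ → refl)
Sum-swap (x ∷ xs) ys f =
  trans (cong (Sum ys (f x) ℕ.+_) (Sum-swap xs ys f)) (sym (Sum-+ ys _ _))

Sum-swap² : (xs : List X) (ys : List Y) (zs : List Z) (ws : List W) (f : X → Y → Z → W → ℕ) →
  (Σ[ x ∈ xs ] Σ[ y ∈ ys ] Σ[ z ∈ zs ] Σ[ w ∈ ws ] f x y z w)
    ≡ (Σ[ z ∈ zs ] Σ[ w ∈ ws ] Σ[ x ∈ xs ] Σ[ y ∈ ys ] f x y z w)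
Sum-swap² xs ys zs ws f = begin
  (Σ[ x ∈ xs ] Σ[ y ∈ ys ] Σ[ z ∈ zs ] Σ[ w ∈ ws ] f x y z w)
    ≡⟨ Sum-cong xs (λ x → Sum-swap ys zs λ y z → Σ[ w ∈ ws ] f x y z w) ⟩
  (Σ[ x ∈ xs ] Σ[ z ∈ zs ] Σ[ y ∈ ys ] Σ[ w ∈ ws ] f x y z w)
    ≡⟨ Sum-swap xs zs (λ x z → Σ[ y ∈ ys ] Σ[ w ∈ ws ] f x y z w) ⟩
  (Σ[ z ∈ zs ] Σ[ x ∈ xs ] Σ[ y ∈ ys ] Σ[ w ∈ ws ] f x y z w)
    ≡⟨ Sum-cong zs (λ z → Sum-cong xs λ x → Sum-swap ys ws λ y w → f x y z w) ⟩
  (Σ[ z ∈ zs ] Σ[ x ∈ xs ] Σ[ w ∈ ws ] Σ[ y ∈ ys ] f x y z w)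
    ≡⟨ Sum-cong zs (λ z → Sum-swap xs ws λ x w → Σ[ y ∈ ys ] f x y z w) ⟩
  (Σ[ z ∈ zs ] Σ[ w ∈ ws ] Σ[ x ∈ xs ] Σ[ y ∈ ys ] f x y z w) ∎

Sum-cartesianProductWith : ∀ (h : X → Y → Z) xs ys (f : Z → ℕ) →
  Sum (cartesianProductWith h xs ys) f ≡ (Σ[ x ∈ xs ] Σ[ y ∈ ys ] f (h x y))
Sum-cartesianProductWith h []       ys f = refl
Sum-cartesianProductWith h (x ∷ xs) ys f = begin
  sum (map f (map (h x) ys ++ rest))
    ≡⟨ cong sum (List.map-++ f (map (h x) ys) rest) ⟩
  sum (map f (map (h x) ys) ++ map f rest)
    ≡⟨ sum-++ (map f (map (h x) ys)) _ ⟩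
  sum (map f (map (h x) ys)) ℕ.+ Sum rest f
    ≡⟨ cong₂ ℕ._+_ (cong sum (sym (List.map-∘ ys))) (Sum-cartesianProductWith h xs ys f) ⟩
  Sum ys (f ∘ h x) ℕ.+ (Σ[ x ∈ xs ] Σ[ y ∈ ys ] f (h x y)) ∎
  where rest = cartesianProductWith h xs ys

Sum-allFin : ∀ n (f : Fin (suc n) → ℕ) →
             Sum (allFin (suc n)) f ≡ f zero ℕ.+ Sum (allFin n) (f ∘ suc)
Sum-allFin n f = cong (λ l → f zero ℕ.+ sum l)
  (trans (List.map-tabulate suc f) (sym (List.map-tabulate id (f ∘ suc))))

subsets : ∀ n → List (Subset n)
subsets = vectors (false ∷ true ∷ [])

Sum-subsets : ∀ n (f : Subset (suc n) → ℕ) →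
  Sum (subsets (suc n)) f ≡ Sum (subsets n) (f ∘ (false ∷_)) ℕ.+ Sum (subsets n) (f ∘ (true ∷_))
Sum-subsets n f = trans (Sum-cartesianProductWith _∷_ (false ∷ true ∷ []) (subsets n) f)
  (cong (Sum (subsets n) (f ∘ (false ∷_)) ℕ.+_) (ℕ.+-identityʳ (Sum (subsets n) (f ∘ (true ∷_)))))

Sum-graphs : ∀ r s (f : BiGraph (suc r) s → ℕ) →
  Sum (allBiGraphs (suc r) s) f ≡ (Σ[ p ∈ subsets s ] Σ[ G ∈ allBiGraphs r s ] f (p ∷ G))
Sum-graphs r s = Sum-cartesianProductWith _∷_ (subsets s) (allBiGraphs r s)

Sum-subsets-unique : ∀ {n} (A : Subset n) (f : Subset n → ℕ) →
                     (∀ B → B ≢ A → f B ≡ 0) → Sum (subsets n) f ≡ f A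
Sum-subsets-unique         []          f h = ℕ.+-identityʳ (f [])
Sum-subsets-unique {suc n} (false ∷ A) f h = begin
  Sum (subsets (suc n)) f
    ≡⟨ Sum-subsets n f ⟩
  Sum (subsets n) (f ∘ (false ∷_)) ℕ.+ Sum (subsets n) (f ∘ (true ∷_))
    ≡⟨ cong₂ ℕ._+_ (Sum-subsets-unique A (f ∘ (false ∷_)) λ B ne → h (false ∷ B) λ { refl → ne refl })
                   (Sum-0 (subsets n) λ B → h (true ∷ B) λ ()) ⟩
  f (false ∷ A) ℕ.+ 0
    ≡⟨ ℕ.+-identityʳ _ ⟩
  f (false ∷ A) ∎
Sum-subsets-unique {suc n} (true ∷ A) f h =
  trans (Sum-subsets n f)
  (cong₂ ℕ._+_ (Sum-0 (subsets n) λ B → h (false ∷ B) λ ())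
               (Sum-subsets-unique A (f ∘ (true ∷_)) λ B ne → h (true ∷ B) λ { refl → ne refl }))

-- Sums over antidiagonals

-- The sum of g i j over all i + j = n; it avoids truncated subtraction.
anti : ℕ → (ℕ → ℕ → ℕ) → ℕ
anti zero    g = g 0 0
anti (suc n) g = g 0 (suc n) ℕ.+ anti n (g ∘ suc)

anti-cong : ∀ n {f g : ℕ → ℕ → ℕ} → (∀ i j → i ℕ.+ j ≡ n → f i j ≡ g i j) → anti n f ≡ anti n g
anti-cong zero    h = h 0 0 refl
anti-cong (suc n) h = cong₂ ℕ._+_ (h 0 (suc n) refl) (anti-cong n λ i j e → h (suc i) j (cong suc e))

anti-0 : ∀ n → anti n (λ _ _ → 0) ≡ 0
anti-0 zero    = refl
anti-0 (suc n) = anti-0 n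

anti-+ : ∀ n f g → anti n (λ i j → f i j ℕ.+ g i j) ≡ anti n f ℕ.+ anti n g
anti-+ zero    f g = refl
anti-+ (suc n) f g = trans (cong (f 0 (suc n) ℕ.+ g 0 (suc n) ℕ.+_) (anti-+ n _ _))
                           (interchange (f 0 (suc n)) _ _ _)

anti-sucʳ : ∀ n g → anti (suc n) g ≡ anti n (λ i j → g i (suc j)) ℕ.+ g (suc n) 0
anti-sucʳ zero    g = refl
anti-sucʳ (suc n) g = trans (cong (g 0 (suc (suc n)) ℕ.+_) (anti-sucʳ n (g ∘ suc)))
                            (sym (ℕ.+-assoc (g 0 (suc (suc n))) _ _))

anti-*ˡ : ∀ n c f → anti n (λ i j → c ℕ.* f i j) ≡ c ℕ.* anti n f
anti-*ˡ zero    c f = refl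
anti-*ˡ (suc n) c f = trans (cong (c ℕ.* f 0 (suc n) ℕ.+_) (anti-*ˡ n c (f ∘ suc)))
                            (sym (ℕ.*-distribˡ-+ c (f 0 (suc n)) _))

Sum-anti : ∀ (xs : List X) n (f : X → ℕ → ℕ → ℕ) →
           (Σ[ x ∈ xs ] anti n (f x)) ≡ anti n (λ i j → Σ[ x ∈ xs ] f x i j)
Sum-anti xs zero    f = refl
Sum-anti xs (suc n) f = trans (Sum-+ xs _ _) (cong (Sum xs (λ x → f x 0 (suc n)) ℕ.+_) (Sum-anti xs n _))

-- The binomial coefficient of i + j over i, indexed by the sizes of a subset and of its complement,
-- so that Pascal's rule needs no subtraction and an antidiagonal supplies both indices.
bin : ℕ → ℕ → ℕ
bin zero    j       = 1
bin (suc i) zero    = 1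
bin (suc i) (suc j) = bin i (suc j) ℕ.+ bin (suc i) j

bin-! : ∀ i j → bin i j ℕ.* (i ! ℕ.* j !) ≡ (i ℕ.+ j) !
bin-! zero    j       = trans (ℕ.+-identityʳ _) (ℕ.+-identityʳ _)
bin-! (suc i) zero    rewrite ℕ.+-identityʳ i = trans (ℕ.+-identityʳ _) (ℕ.*-identityʳ _)
bin-! (suc i) (suc j) = begin
  (a ℕ.+ b) ℕ.* (suc i ! ℕ.* suc j !)
    -- Each half of Pascal's rule gives up one factor, `suc i` or `suc j`, to match the induction
    -- hypotheses; their sum is the leading factor of (i + j + 2)!.
    ≡⟨ solve 6 (λ a b i j p q → (a :+ b) :* (((con 1 :+ i) :* p) :* ((con 1 :+ j) :* q))
         := (con 1 :+ i) :* (a :* (p :* ((con 1 :+ j) :* q))) :+ (con 1 :+ j) :* (b :* (((con 1 :+ i) :* p) :* q)))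
         refl a b i j (i !) (j !) ⟩
  suc i ℕ.* (a ℕ.* (i ! ℕ.* suc j !)) ℕ.+ suc j ℕ.* (b ℕ.* (suc i ! ℕ.* j !))
    ≡⟨ cong₂ (λ x y → suc i ℕ.* x ℕ.+ suc j ℕ.* y) (bin-! i (suc j)) (bin-! (suc i) j) ⟩
  suc i ℕ.* (i ℕ.+ suc j) ! ℕ.+ suc j ℕ.* (suc i ℕ.+ j) !
    ≡⟨ cong (λ z → suc i ℕ.* (i ℕ.+ suc j) ! ℕ.+ suc j ℕ.* z !) (sym (ℕ.+-suc i j)) ⟩
  suc i ℕ.* (i ℕ.+ suc j) ! ℕ.+ suc j ℕ.* (i ℕ.+ suc j) !
    ≡⟨ sym (ℕ.*-distribʳ-+ ((i ℕ.+ suc j) !) (suc i) (suc j)) ⟩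
  (suc i ℕ.+ suc j) ! ∎
  where
  open ℕ-Solver.+-*-Solver
  a = bin i (suc j)
  b = bin (suc i) j

-- Induction on n: the first element lies outside or inside A, and the two resulting sums recombine
-- by Pascal's rule.
Sum-subsets-card : ∀ n (g : ℕ → ℕ → ℕ) →
  (Σ[ A ∈ subsets n ] g (card A) (card (∁ A))) ≡ anti n (λ i j → bin i j ℕ.* g i j)
Sum-subsets-card zero    g = refl
Sum-subsets-card (suc n) g = begin
  (Σ[ A ∈ subsets (suc n) ] g (card A) (card (∁ A)))
    ≡⟨ Sum-subsets n (λ A → g (card A) (card (∁ A))) ⟩
  (Σ[ A ∈ subsets n ] g (card A) (suc (card (∁ A)))) ℕ.+ (Σ[ A ∈ subsets n ] g (suc (card A)) (card (∁ A)))
    ≡⟨ cong₂ ℕ._+_ (Sum-subsets-card n (λ i j → g i (suc j))) (Sum-subsets-card n (g ∘ suc)) ⟩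
  anti n (λ i j → h₁ i (suc j)) ℕ.+ anti n (h₂ ∘ suc)
    ≡⟨ cong (ℕ._+ anti n (h₂ ∘ suc)) (sym (trans (anti-sucʳ n h₁) (ℕ.+-identityʳ _))) ⟩
  anti (suc n) h₁ ℕ.+ anti (suc n) h₂
    ≡⟨ sym (anti-+ (suc n) h₁ h₂) ⟩
  anti (suc n) (λ i j → h₁ i j ℕ.+ h₂ i j)
    ≡⟨ anti-cong (suc n) pascal ⟩
  anti (suc n) (λ i j → bin i j ℕ.* g i j) ∎
  where
  -- The shares of the subsets without and with the first element, extended by zero at the border so
  -- that both run over the same antidiagonal.
  h₁ h₂ : ℕ → ℕ → ℕ
  h₁ i zero    = 0
  h₁ i (suc j) = bin i j ℕ.* g i (suc j)
  h₂ zero    j = 0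
  h₂ (suc i) j = bin i j ℕ.* g (suc i) j
  pascal : ∀ i j → i ℕ.+ j ≡ suc n → h₁ i j ℕ.+ h₂ i j ≡ bin i j ℕ.* g i j
  pascal zero    (suc j) _ = ℕ.+-identityʳ _
  pascal (suc zero)    zero _ = refl
  pascal (suc (suc i)) zero _ = refl
  pascal (suc i) (suc j) _ = trans (ℕ.+-comm (bin (suc i) j ℕ.* g (suc i) (suc j)) _)
    (sym (ℕ.*-distribʳ-+ (g (suc i) (suc j)) (bin i (suc j)) (bin (suc i) j)))

δ : ℕ → ℕ → ℕ
δ m n = χ (m ≡ᵇ n)

δ-+ˡ : ∀ p a b → δ (p ℕ.+ a) (p ℕ.+ b) ≡ δ a b
δ-+ˡ zero    a b = refl
δ-+ˡ (suc p) a b = δ-+ˡ p a b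

-- Both sides vanish unless a = b. Under a sum this exchanges a prescribed number of edges for
-- `edges G`.
δ-*-comm : ∀ a b → δ a b ℕ.* b ≡ δ a b ℕ.* a
δ-*-comm zero    zero    = refl
δ-*-comm zero    (suc b) = refl
δ-*-comm (suc a) zero    = refl
δ-*-comm (suc a) (suc b) = begin
  δ a b ℕ.* suc b          ≡⟨ ℕ.*-suc (δ a b) b ⟩
  δ a b ℕ.+ δ a b ℕ.* b    ≡⟨ cong (δ a b ℕ.+_) (δ-*-comm a b) ⟩
  δ a b ℕ.+ δ a b ℕ.* a    ≡⟨ sym (ℕ.*-suc (δ a b) a) ⟩
  δ a b ℕ.* suc a          ∎

-- The only term that can survive is l = a, l′ = b, and it lies on the antidiagonal exactly when a +
-- b = m.
anti-δ : ∀ m a b → anti m (λ l l′ → δ a l ℕ.* δ b l′) ≡ δ (a ℕ.+ b) m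
anti-δ zero    zero    b = ℕ.+-identityʳ _
anti-δ zero    (suc a) b = refl
anti-δ (suc m) zero    b =
  trans (cong₂ ℕ._+_ (ℕ.+-identityʳ (δ b (suc m))) (anti-0 m)) (ℕ.+-identityʳ _)
anti-δ (suc m) (suc a) b = anti-δ m a b

-- Induced subgraphs

restrict : ∀ {n} (A : Subset n) → Vec X n → Vec X (card A)
restrict []          []       = []
restrict (true  ∷ A) (x ∷ xs) = x ∷ restrict A xs
restrict (false ∷ A) (x ∷ xs) = restrict A xs

embed : ∀ {n} (A : Subset n) → Fin (card A) → Fin n
embed (true  ∷ A) zero    = zero
embed (true  ∷ A) (suc i) = suc (embed A i)
embed (false ∷ A) i       = suc (embed A i)

lookup-embed : ∀ {n} (A : Subset n) i → lookup A (embed A i) ≡ true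
lookup-embed (true  ∷ A) zero    = refl
lookup-embed (true  ∷ A) (suc i) = lookup-embed A i
lookup-embed (false ∷ A) i       = lookup-embed A i

embed-surjective : ∀ {n} (A : Subset n) i → lookup A i ≡ true → ∃[ i′ ] embed A i′ ≡ i
embed-surjective (true  ∷ A) zero    _ = zero , refl
embed-surjective (true  ∷ A) (suc i) e with i′ , refl ← embed-surjective A i e = suc i′ , refl
embed-surjective (false ∷ A) (suc i) e with i′ , refl ← embed-surjective A i e = i′ , refl

embed-injective : ∀ {n} (A : Subset n) i j → embed A i ≡ embed A j → i ≡ j
embed-injective (true  ∷ A) zero    zero    e = refl
embed-injective (true  ∷ A) (suc i) (suc j) e = cong suc (embed-injective A i j (Fin.suc-injective e))
embed-injective (false ∷ A) i       j       e = embed-injective A i j (Fin.suc-injective e)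

lookup-restrict : ∀ {n} (A : Subset n) (xs : Vec X n) i →
                  lookup (restrict A xs) i ≡ lookup xs (embed A i)
lookup-restrict (true  ∷ A) (x ∷ xs) zero    = refl
lookup-restrict (true  ∷ A) (x ∷ xs) (suc i) = lookup-restrict A xs i
lookup-restrict (false ∷ A) (x ∷ xs) i       = lookup-restrict A xs i

induced : ∀ {r s} (A : Subset r) (B : Subset s) → BiGraph r s → BiGraph (card A) (card B)
induced A B G = Vec.map (restrict B) (restrict A G)

has : ∀ {r s} → BiGraph r s → Fin r → Fin s → Bool
has G i j = lookup (lookup G i) j

has-induced : ∀ {r s} (A : Subset r) (B : Subset s) (G : BiGraph r s) i j →
              has (induced A B G) i j ≡ has G (embed A i) (embed B j)
has-induced A B G i j = begin
  lookup (lookup (Vec.map (restrict B) (restrict A G)) i) j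
    ≡⟨ cong (λ p → lookup p j) (Vec.lookup-map i (restrict B) (restrict A G)) ⟩
  lookup (restrict B (lookup (restrict A G) i)) j
    ≡⟨ lookup-restrict B (lookup (restrict A G) i) j ⟩
  lookup (lookup (restrict A G) i) (embed B j)
    ≡⟨ cong (λ p → lookup p (embed B j)) (lookup-restrict A G i) ⟩
  has G (embed A i) (embed B j) ∎

-- Inclusion as a Boolean, by recursion on the entries so that sums over subsets can be split along
-- it.
within : ∀ {n} → Subset n → Subset n → Bool
within []      []      = true
within (x ∷ p) (b ∷ B) = (not x ∨ b) ∧ within p B

-- separates A B G: no edge of G joins A ⊔ B to its complement.
separates : ∀ {r s} → Subset r → Subset s → BiGraph r s → Bool
separates []          B []      = true
separates (true  ∷ A) B (p ∷ G) = within p B ∧ separates A B G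
separates (false ∷ A) B (p ∷ G) = within p (∁ B) ∧ separates A B G

∧-true : ∀ {a b} → a ∧ b ≡ true → a ≡ true × b ≡ true
∧-true {true} {true} refl = refl , refl

within⇒ : ∀ {n} (p B : Subset n) → within p B ≡ true → ∀ j → lookup p j ≡ true → lookup B j ≡ true
within⇒ (true ∷ p) (true ∷ B) e zero    _ = refl
within⇒ (x ∷ p)    (b ∷ B)    e (suc j) h = within⇒ p B (proj₂ (∧-true {not x ∨ b} e)) j h

⇒within : ∀ {n} (p B : Subset n) → (∀ j → lookup p j ≡ true → lookup B j ≡ true) → within p B ≡ true
⇒within []          []      h = refl
⇒within (false ∷ p) (b ∷ B) h = ⇒within p B (h ∘ suc)
⇒within (true ∷ p)  (b ∷ B) h with refl ← h zero refl = ⇒within p B (h ∘ suc)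

lookup-∁ : ∀ {n} (B : Subset n) j → lookup (∁ B) j ≡ not (lookup B j)
lookup-∁ B j = Vec.lookup-map j not B

not-true : ∀ {b} → not b ≡ true → false ≡ b
not-true {false} _ = refl

separates⇒ : ∀ {r s} A B (G : BiGraph r s) → separates A B G ≡ true →
             ∀ i j → has G i j ≡ true → lookup A i ≡ lookup B j
separates⇒ (true ∷ A)  B (p ∷ G) e zero    j h = sym (within⇒ p B (proj₁ (∧-true e)) j h)
separates⇒ (false ∷ A) B (p ∷ G) e zero    j h =
  not-true (trans (sym (lookup-∁ B j)) (within⇒ p (∁ B) (proj₁ (∧-true e)) j h))
separates⇒ (true ∷ A)  B (p ∷ G) e (suc i) j h = separates⇒ A B G (proj₂ (∧-true {within p B} e)) i j h
separates⇒ (false ∷ A) B (p ∷ G) e (suc i) j h = separates⇒ A B G (proj₂ (∧-true {within p (∁ B)} e)) i j h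

⇒separates : ∀ {r s} A B (G : BiGraph r s) →
             (∀ i j → has G i j ≡ true → lookup A i ≡ lookup B j) → separates A B G ≡ true
⇒separates []          B []      h = refl
⇒separates (true ∷ A)  B (p ∷ G) h =
  cong₂ _∧_ (⇒within p B λ j e → sym (h zero j e)) (⇒separates A B G (h ∘ suc))
⇒separates (false ∷ A) B (p ∷ G) h =
  cong₂ _∧_ (⇒within p (∁ B) λ j e → trans (lookup-∁ B j) (cong not (sym (h zero j e))))
            (⇒separates A B G (h ∘ suc))

card-restrict : ∀ {n} (p B : Subset n) → within p B ≡ true → card p ≡ card (restrict B p)
card-restrict []          []          e = refl
card-restrict (false ∷ p) (false ∷ B) e = card-restrict p B e
card-restrict (false ∷ p) (true  ∷ B) e = card-restrict p B e
card-restrict (true  ∷ p) (true  ∷ B) e = cong suc (card-restrict p B e)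

-- Each row lies wholly in B or wholly in `∁ B`, according to the side of its vertex, so restricting
-- the row loses no edge.
edges-separated : ∀ {r s} A B (G : BiGraph r s) → separates A B G ≡ true →
                  edges G ≡ edges (induced A B G) ℕ.+ edges (induced (∁ A) (∁ B) G)
edges-separated []          B []      e = refl
edges-separated (true  ∷ A) B (p ∷ G) e =
  trans (cong₂ ℕ._+_ (card-restrict p B (proj₁ (∧-true e))) (edges-separated A B G (proj₂ (∧-true {within p B} e))))
        (sym (ℕ.+-assoc (card (restrict B p)) _ _))
edges-separated (false ∷ A) B (p ∷ G) e = begin
  card p ℕ.+ edges G
    ≡⟨ cong₂ ℕ._+_ (card-restrict p (∁ B) (proj₁ (∧-true e)))
                   (edges-separated A B G (proj₂ (∧-true {within p (∁ B)} e))) ⟩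
  c ℕ.+ (e₁ ℕ.+ e₂) ≡⟨ sym (ℕ.+-assoc c e₁ e₂) ⟩
  c ℕ.+ e₁ ℕ.+ e₂   ≡⟨ cong (ℕ._+ e₂) (ℕ.+-comm c e₁) ⟩
  e₁ ℕ.+ c ℕ.+ e₂   ≡⟨ ℕ.+-assoc e₁ c e₂ ⟩
  e₁ ℕ.+ (c ℕ.+ e₂) ∎
  where
  c  = (card (restrict (∁ B) p))
  e₁ = edges (induced A B G)
  e₂ = edges (induced (∁ A) (∁ B) G)

-- Restriction is a bijection from the subsets of B to all subsets of a set with `card B` elements;
-- at an index outside B only the entry `false` contributes.
Sum-within : ∀ {n} (B : Subset n) (g : Subset (card B) → ℕ) →
  (Σ[ p ∈ subsets n ] χ (within p B) ℕ.* g (restrict B p)) ≡ Sum (subsets (card B)) g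
Sum-within []                  g = cong (ℕ._+ 0) (ℕ.+-identityʳ (g []))
Sum-within {suc n} (true  ∷ B) g = begin
  Sum (subsets (suc n)) (λ p → χ (within p (true ∷ B)) ℕ.* g (restrict (true ∷ B) p))
    ≡⟨ Sum-subsets n _ ⟩
  _ ≡⟨ cong₂ ℕ._+_ (Sum-within B (g ∘ (false ∷_))) (Sum-within B (g ∘ (true ∷_))) ⟩
  Sum (subsets (card B)) (g ∘ (false ∷_)) ℕ.+ Sum (subsets (card B)) (g ∘ (true ∷_))
    ≡⟨ sym (Sum-subsets (card B) g) ⟩
  Sum (subsets (card (true ∷ B))) g ∎
Sum-within {suc n} (false ∷ B) g = begin
  Sum (subsets (suc n)) (λ p → χ (within p (false ∷ B)) ℕ.* g (restrict (false ∷ B) p))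
    ≡⟨ Sum-subsets n _ ⟩
  _ ≡⟨ cong₂ ℕ._+_ (Sum-within B g) (Sum-0 (subsets n) λ _ → refl) ⟩
  Sum (subsets (card B)) g ℕ.+ 0
    ≡⟨ ℕ.+-identityʳ _ ⟩
  Sum (subsets (card B)) g ∎

-- A graph without edges between the two sides amounts to a pair of graphs, one on each side, and
-- every pair arises once. The induction hands each row to the graph on the side of its vertex.
Sum-separated : ∀ {r s} (A : Subset r) (B : Subset s)
  (f : BiGraph (card A) (card B) → BiGraph (card (∁ A)) (card (∁ B)) → ℕ) →
  (Σ[ G ∈ allBiGraphs r s ] χ (separates A B G) ℕ.* f (induced A B G) (induced (∁ A) (∁ B) G))
    ≡ (Σ[ G₁ ∈ allBiGraphs (card A) (card B) ] Σ[ G₂ ∈ allBiGraphs (card (∁ A)) (card (∁ B)) ] f G₁ G₂)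
Sum-separated []          B f = refl
Sum-separated {suc r} {s} (true ∷ A) B f = begin
  _ ≡⟨ Sum-graphs r s _ ⟩
  (Σ[ p ∈ subsets s ] Σ[ G ∈ allBiGraphs r s ]
     χ (within p B ∧ separates A B G) ℕ.* f (restrict B p ∷ induced A B G) (induced (∁ A) (∁ B) G))
    ≡⟨ Sum-cong (subsets s) (λ p → Sum-χ-∧ (allBiGraphs r s) (within p B) (separates A B) _) ⟩
  (Σ[ p ∈ subsets s ] χ (within p B) ℕ.* (Σ[ G ∈ allBiGraphs r s ]
     χ (separates A B G) ℕ.* f (restrict B p ∷ induced A B G) (induced (∁ A) (∁ B) G)))
    ≡⟨ Sum-cong (subsets s) (λ p → cong (χ (within p B) ℕ.*_)
         (Sum-separated A B (λ G₁ G₂ → f (restrict B p ∷ G₁) G₂))) ⟩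
  (Σ[ p ∈ subsets s ] χ (within p B) ℕ.* (Σ[ G₁ ∈ allBiGraphs (card A) (card B) ]
     Σ[ G₂ ∈ allBiGraphs (card (∁ A)) (card (∁ B)) ] f (restrict B p ∷ G₁) G₂))
    ≡⟨ Sum-within B _ ⟩
  (Σ[ p ∈ subsets (card B) ] Σ[ G₁ ∈ allBiGraphs (card A) (card B) ]
     Σ[ G₂ ∈ allBiGraphs (card (∁ A)) (card (∁ B)) ] f (p ∷ G₁) G₂)
    ≡⟨ sym (Sum-graphs (card A) (card B) _) ⟩
  _ ∎
Sum-separated {suc r} {s} (false ∷ A) B f = begin
  _ ≡⟨ Sum-graphs r s _ ⟩
  (Σ[ p ∈ subsets s ] Σ[ G ∈ allBiGraphs r s ]
     χ (within p (∁ B) ∧ separates A B G) ℕ.* f (induced A B G) (restrict (∁ B) p ∷ induced (∁ A) (∁ B) G))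
    ≡⟨ Sum-cong (subsets s) (λ p → Sum-χ-∧ (allBiGraphs r s) (within p (∁ B)) (separates A B) _) ⟩
  (Σ[ p ∈ subsets s ] χ (within p (∁ B)) ℕ.* (Σ[ G ∈ allBiGraphs r s ]
     χ (separates A B G) ℕ.* f (induced A B G) (restrict (∁ B) p ∷ induced (∁ A) (∁ B) G)))
    ≡⟨ Sum-cong (subsets s) (λ p → cong (χ (within p (∁ B)) ℕ.*_)
         (Sum-separated A B (λ G₁ G₂ → f G₁ (restrict (∁ B) p ∷ G₂)))) ⟩
  (Σ[ p ∈ subsets s ] χ (within p (∁ B)) ℕ.* (Σ[ G₁ ∈ allBiGraphs (card A) (card B) ]
     Σ[ G₂ ∈ allBiGraphs (card (∁ A)) (card (∁ B)) ] f G₁ (restrict (∁ B) p ∷ G₂)))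
    ≡⟨ Sum-within (∁ B) _ ⟩
  (Σ[ p ∈ subsets (card (∁ B)) ] Σ[ G₁ ∈ allBiGraphs (card A) (card B) ]
     Σ[ G₂ ∈ allBiGraphs (card (∁ A)) (card (∁ B)) ] f G₁ (p ∷ G₂))
    -- The row belongs to `G₂`, so its sum has to move inside the one over `G₁` before it can be
    -- absorbed.
    ≡⟨ Sum-swap (subsets (card (∁ B))) (allBiGraphs (card A) (card B)) _ ⟩
  (Σ[ G₁ ∈ allBiGraphs (card A) (card B) ] Σ[ p ∈ subsets (card (∁ B)) ]
     Σ[ G₂ ∈ allBiGraphs (card (∁ A)) (card (∁ B)) ] f G₁ (p ∷ G₂))
    ≡⟨ Sum-cong (allBiGraphs (card A) (card B)) (λ G₁ → sym (Sum-graphs (card (∁ A)) (card (∁ B)) (f G₁))) ⟩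
  _ ∎

-- Connectedness

does-true : ∀ {P : Set} (P? : Dec P) → does P? ≡ true → P
does-true (yes p) _ = p

has⇒Adj : ∀ {r s} (G : BiGraph r s) {i j} → has G i j ≡ true → Adj G (inj₁ i) (inj₂ j)
has⇒Adj G {i} {j} e = Vec.lookup⇒[]= j (lookup G i) e

Adj⇒has : ∀ {r s} (G : BiGraph r s) {i j} → Adj G (inj₁ i) (inj₂ j) → has G i j ≡ true
Adj⇒has G = Vec.[]=⇒lookup

Adj-sym : ∀ {r s} (G : BiGraph r s) {x y} → Adj G x y → Adj G y x
Adj-sym G {inj₁ _} {inj₂ _} e = e
Adj-sym G {inj₂ _} {inj₁ _} e = e

reverse : ∀ {r s} (G : BiGraph r s) {x y} → Star (Adj G) x y → Star (Adj G) y x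
reverse G = Star.reverse λ {x} {y} → Adj-sym G {x} {y}

Adj-map : ∀ {r s r′ s′} (G : BiGraph r s) (H : BiGraph r′ s′) (f : Fin r → Fin r′) (g : Fin s → Fin s′) →
          (∀ i j → has G i j ≡ true → has H (f i) (g j) ≡ true) →
          ∀ {x y} → Adj G x y → Adj H (Sum.map f g x) (Sum.map f g y)
Adj-map G H f g h {inj₁ i} {inj₂ j} e = has⇒Adj H (h i j (Adj⇒has G e))
Adj-map G H f g h {inj₂ j} {inj₁ i} e = has⇒Adj H (h i j (Adj⇒has G e))

abstract

  -- Opaque, so that `conn G` stays an atom in the sums instead of unfolding to the search for
  -- walks; only `conn≡does` reveals it.
  conn : ∀ {r s} → BiGraph r s → Bool
  conn G = does (connected? G)

  conn≡does : ∀ {r s} (G : BiGraph r s) → conn G ≡ does (connected? G)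
  conn≡does G = refl

conn⇒Connected : ∀ {r s} (G : BiGraph r s) → conn G ≡ true → Connected G
conn⇒Connected G e = does-true (connected? G) (trans (sym (conn≡does G)) e)

Connected⇒conn : ∀ {r s} (G : BiGraph r s) → Connected G → conn G ≡ true
Connected⇒conn G c = trans (conn≡does G) (dec-true (connected? G) c)

colour : ∀ {r s} → Subset r → Subset s → Vertex r s → Bool
colour A B (inj₁ i) = lookup A i
colour A B (inj₂ j) = lookup B j

colour-∁ : ∀ {r s} (A : Subset r) (B : Subset s) x → colour (∁ A) (∁ B) x ≡ not (colour A B x)
colour-∁ A B (inj₁ i) = lookup-∁ A i
colour-∁ A B (inj₂ j) = lookup-∁ B j

Respects : ∀ {r s} → Subset r → Subset s → BiGraph r s → Set
Respects A B G = ∀ x y → Adj G x y → colour A B x ≡ colour A B y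

-- G has at most the two components A ⊔ B and its complement.
Splits : ∀ {r s} → Subset r → Subset s → BiGraph r s → Set
Splits A B G = Respects A B G × (∀ x y → colour A B x ≡ colour A B y → Star (Adj G) x y)

colour-star : ∀ {r s} (A : Subset r) (B : Subset s) G → Respects A B G →
              ∀ {x y} → Star (Adj G) x y → colour A B x ≡ colour A B y
colour-star A B G h ε                  = refl
colour-star A B G h (_◅_ {x} {y} e es) = trans (h x y e) (colour-star A B G h es)

embedᵥ : ∀ {r s} (A : Subset r) (B : Subset s) → Vertex (card A) (card B) → Vertex r s
embedᵥ A B = Sum.map (embed A) (embed B)

colour-embedᵥ : ∀ {r s} (A : Subset r) (B : Subset s) x → colour A B (embedᵥ A B x) ≡ true
colour-embedᵥ A B (inj₁ i) = lookup-embed A i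
colour-embedᵥ A B (inj₂ j) = lookup-embed B j

embedᵥ-surjective : ∀ {r s} (A : Subset r) (B : Subset s) x → colour A B x ≡ true →
                    ∃[ x′ ] embedᵥ A B x′ ≡ x
embedᵥ-surjective A B (inj₁ i) e with i′ , refl ← embed-surjective A i e = inj₁ i′ , refl
embedᵥ-surjective A B (inj₂ j) e with j′ , refl ← embed-surjective B j e = inj₂ j′ , refl

embedᵥ-injective : ∀ {r s} (A : Subset r) (B : Subset s) x y → embedᵥ A B x ≡ embedᵥ A B y → x ≡ y
embedᵥ-injective A B (inj₁ i) (inj₁ j) e = cong inj₁ (embed-injective A i j (Sum.inj₁-injective e))
embedᵥ-injective A B (inj₂ i) (inj₂ j) e = cong inj₂ (embed-injective B i j (Sum.inj₂-injective e))

Adj-induced : ∀ {r s} (A : Subset r) (B : Subset s) G x y →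
              Adj G (embedᵥ A B x) (embedᵥ A B y) → Adj (induced A B G) x y
Adj-induced A B G (inj₁ i) (inj₂ j) e = has⇒Adj (induced A B G) (trans (has-induced A B G i j) (Adj⇒has G e))
Adj-induced A B G (inj₂ j) (inj₁ i) e = has⇒Adj (induced A B G) (trans (has-induced A B G i j) (Adj⇒has G e))

Connected-induced⇒ : ∀ {r s} (A : Subset r) (B : Subset s) G → Connected (induced A B G) →
                     ∀ x y → colour A B x ≡ true → colour A B y ≡ true → Star (Adj G) x y
Connected-induced⇒ A B G (_ , c) x y ex ey
  with x′ , refl ← embedᵥ-surjective A B x ex | y′ , refl ← embedᵥ-surjective A B y ey
  = Star.gmap (embedᵥ A B)
      (λ {x} {y} → Adj-map (induced A B G) G (embed A) (embed B)
        (λ i j e → trans (sym (has-induced A B G i j)) e) {x} {y})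
      (c x′ y′)

-- A walk that starts inside A ⊔ B stays there, because every edge preserves the colour, so it can
-- be pulled back vertex by vertex. The vertex x supplies the nonemptiness contained in `Connected`.
⇒Connected-induced : ∀ {r s} (A : Subset r) (B : Subset s) G → Respects A B G →
                     (∀ x y → colour A B x ≡ true → colour A B y ≡ true → Star (Adj G) x y) →
                     ∀ x → colour A B x ≡ true → Connected (induced A B G)
⇒Connected-induced A B G respects c x ex = proj₁ (embedᵥ-surjective A B x ex) , connected
  where
  pull : ∀ x′ {y} → Star (Adj G) (embedᵥ A B x′) y → ∃[ y′ ] embedᵥ A B y′ ≡ y × Star (Adj (induced A B G)) x′ y′
  pull x′ ε = x′ , refl , ε
  pull x′ (_◅_ {j = w} e es)
    with w′ , refl ← embedᵥ-surjective A B w (trans (sym (respects _ w e)) (colour-embedᵥ A B x′))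
    with y′ , eq , p ← pull w′ es
    = y′ , eq , Adj-induced A B G x′ w′ e ◅ p
  connected : ∀ x′ y′ → Star (Adj (induced A B G)) x′ y′
  connected x′ y′
    with y″ , eq , p ← pull x′ (c _ _ (colour-embedᵥ A B x′) (colour-embedᵥ A B y′))
    with refl ← embedᵥ-injective A B y″ y′ eq = p

-- Stronger than `Splits`: both sides must be nonempty, because `Connected` demands a vertex. Hence
-- `Splits⇒splits` asks for one vertex of each colour.
splits : ∀ {r s} → Subset r → Subset s → BiGraph r s → Bool
splits A B G = separates A B G ∧ conn (induced A B G) ∧ conn (induced (∁ A) (∁ B) G)

separates⇒Respects : ∀ {r s} (A : Subset r) (B : Subset s) G → separates A B G ≡ true → Respects A B G
separates⇒Respects A B G e (inj₁ i) (inj₂ j) a = separates⇒ A B G e i j (Adj⇒has G a)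
separates⇒Respects A B G e (inj₂ j) (inj₁ i) a = sym (separates⇒ A B G e i j (Adj⇒has G a))

splits⇒Splits : ∀ {r s} (A : Subset r) (B : Subset s) G → splits A B G ≡ true → Splits A B G
splits⇒Splits A B G e = separates⇒Respects A B G sep , star
  where
  sep = proj₁ (∧-true e)
  c₁ = conn⇒Connected (induced A B G) (proj₁ (∧-true (proj₂ (∧-true {separates A B G} e))))
  c₂ = conn⇒Connected (induced (∁ A) (∁ B) G)
         (proj₂ (∧-true {conn (induced A B G)} (proj₂ (∧-true {separates A B G} e))))
  star : ∀ x y → colour A B x ≡ colour A B y → Star (Adj G) x y
  star x y eq with colour A B x in ex
  ... | true  = Connected-induced⇒ A B G c₁ x y ex (sym eq)
  ... | false = Connected-induced⇒ (∁ A) (∁ B) G c₂ x y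
                  (trans (colour-∁ A B x) (cong not ex)) (trans (colour-∁ A B y) (cong not (sym eq)))

module _ {r s : ℕ} (A : Subset r) (B : Subset s) (G : BiGraph r s) (sp : Splits A B G) where

  Splits⇒separates : separates A B G ≡ true
  Splits⇒separates = ⇒separates A B G λ i j e → proj₁ sp (inj₁ i) (inj₂ j) (has⇒Adj G e)

  Splits⇒Connectedˡ : ∀ x → colour A B x ≡ true → Connected (induced A B G)
  Splits⇒Connectedˡ = ⇒Connected-induced A B G (proj₁ sp)
    λ x y ex ey → proj₂ sp x y (trans ex (sym ey))

  Splits⇒Connectedʳ : ∀ x → colour A B x ≡ false → Connected (induced (∁ A) (∁ B) G)
  Splits⇒Connectedʳ x ex = ⇒Connected-induced (∁ A) (∁ B) G respects star x (trans (colour-∁ A B x) (cong not ex))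
    where
    respects : Respects (∁ A) (∁ B) G
    respects x y e = trans (colour-∁ A B x) (trans (cong not (proj₁ sp x y e)) (sym (colour-∁ A B y)))
    uncolour : ∀ x → colour (∁ A) (∁ B) x ≡ true → false ≡ colour A B x
    uncolour x e = not-true (trans (sym (colour-∁ A B x)) e)
    star : ∀ x y → colour (∁ A) (∁ B) x ≡ true → colour (∁ A) (∁ B) y ≡ true → Star (Adj G) x y
    star x y ex ey = proj₂ sp x y (trans (sym (uncolour x ex)) (uncolour y ey))

  Splits⇒splits : ∀ x y → colour A B x ≡ true → colour A B y ≡ false → splits A B G ≡ true
  Splits⇒splits x y ex ey = cong₂ _∧_ Splits⇒separates
    (cong₂ _∧_ (Connected⇒conn _ (Splits⇒Connectedˡ x ex)) (Connected⇒conn _ (Splits⇒Connectedʳ y ey)))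

-- Adding an edge

addEdge : ∀ {r s} → Fin r → Fin s → BiGraph r s → BiGraph r s
addEdge u v G = G [ u ]%= (_[ v ]≔ true)

has-addEdge : ∀ {r s} u v (G : BiGraph r s) → has (addEdge u v G) u v ≡ true
has-addEdge zero    v (p ∷ G) = Vec.lookup∘updateAt v p
has-addEdge (suc u) v (p ∷ G) = has-addEdge u v G

has-addEdge⁺ : ∀ {r s} u v (G : BiGraph r s) i j → has G i j ≡ true → has (addEdge u v G) i j ≡ true
has-addEdge⁺ (suc u) v (p ∷ G) zero    j e = e
has-addEdge⁺ zero    v (p ∷ G) (suc i) j e = e
has-addEdge⁺ (suc u) v (p ∷ G) (suc i) j e = has-addEdge⁺ u v G i j e
has-addEdge⁺ zero    v (p ∷ G) zero    j e with j Fin.≟ v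
... | yes refl = Vec.lookup∘updateAt v p
... | no ne    = trans (Vec.lookup∘updateAt′ j v ne p) e

has-addEdge⁻ : ∀ {r s} u v (G : BiGraph r s) i j → has (addEdge u v G) i j ≡ true →
               has G i j ≡ true ⊎ (i ≡ u × j ≡ v)
has-addEdge⁻ (suc u) v (p ∷ G) zero    j e = inj₁ e
has-addEdge⁻ zero    v (p ∷ G) (suc i) j e = inj₁ e
has-addEdge⁻ (suc u) v (p ∷ G) (suc i) j e with has-addEdge⁻ u v G i j e
... | inj₁ h             = inj₁ h
... | inj₂ (refl , refl) = inj₂ (refl , refl)
has-addEdge⁻ zero    v (p ∷ G) zero    j e with j Fin.≟ v
... | yes refl = inj₂ (refl , refl)
... | no ne    = inj₁ (trans (sym (Vec.lookup∘updateAt′ j v ne p)) e)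

module _ {r s : ℕ} (u : Fin r) (v : Fin s) (G : BiGraph r s) where

  private
    G⁺ = addEdge u v G

  star-addEdge : ∀ {x y} → Star (Adj G) x y → Star (Adj G⁺) x y
  star-addEdge = Star.gmap id λ {x} {y} e → subst₂ (Adj G⁺) (Sum.map-id x) (Sum.map-id y)
    (Adj-map G G⁺ id id (has-addEdge⁺ u v G) {x} {y} e)

  Adj-addEdge⁻ : ∀ x y → Adj G⁺ x y → Adj G x y ⊎ (x ≡ inj₁ u ⊎ x ≡ inj₂ v)
  Adj-addEdge⁻ (inj₁ i) (inj₂ j) e with has-addEdge⁻ u v G i j (Adj⇒has G⁺ e)
  ... | inj₁ h          = inj₁ (has⇒Adj G h)
  ... | inj₂ (refl , _) = inj₂ (inj₁ refl)
  Adj-addEdge⁻ (inj₂ j) (inj₁ i) e with has-addEdge⁻ u v G i j (Adj⇒has G⁺ e)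
  ... | inj₁ h          = inj₁ (has⇒Adj G h)
  ... | inj₂ (_ , refl) = inj₂ (inj₂ refl)

  -- Cut the walk where it first traverses uv: the part before lies in `G` and stops at u or v.
  -- Without such a traversal the whole walk lies in `G`.
  reaches-end : ∀ {x} → Star (Adj G⁺) x (inj₁ u) → Star (Adj G) x (inj₁ u) ⊎ Star (Adj G) x (inj₂ v)
  reaches-end ε = inj₁ ε
  reaches-end (_◅_ {x} {y} e es) with Adj-addEdge⁻ x y e | reaches-end es
  ... | inj₁ a           | inj₁ p = inj₁ (a ◅ p)
  ... | inj₁ a           | inj₂ p = inj₂ (a ◅ p)
  ... | inj₂ (inj₁ refl) | _      = inj₁ ε
  ... | inj₂ (inj₂ refl) | _      = inj₂ ε

  Connected-addEdge : Connected G → Connected G⁺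
  Connected-addEdge (x , c) = x , λ x y → star-addEdge (c x y)

  Splits⇒Connected-addEdge : ∀ A B → Splits A B G → lookup A u ≡ true → lookup B v ≡ false → Connected G⁺
  Splits⇒Connected-addEdge A B (_ , c) eu ev = inj₁ u , λ x y → to-u x ◅◅ reverse G⁺ (to-u y)
    where
    to-u : ∀ x → Star (Adj G⁺) x (inj₁ u)
    to-u x with colour A B x in ex
    ... | true  = star-addEdge (c x (inj₁ u) (trans ex (sym eu)))
    ... | false = star-addEdge (c x (inj₂ v) (trans ex (sym ev))) ◅◅ (has⇒Adj G⁺ (has-addEdge u v G) ◅ ε)

  reached : Vertex r s → Bool
  reached x = does (reachable? G (inj₁ u) x)

  -- `partˡ` and `partʳ` are the left and right vertices of the component of `u` in `G`.
  partˡ : Subset r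
  partˡ = Vec.tabulate (reached ∘ inj₁)

  partʳ : Subset s
  partʳ = Vec.tabulate (reached ∘ inj₂)

  colour-part : ∀ x → colour partˡ partʳ x ≡ reached x
  colour-part (inj₁ i) = Vec.lookup∘tabulate _ i
  colour-part (inj₂ j) = Vec.lookup∘tabulate _ j

  reached-u : reached (inj₁ u) ≡ true
  reached-u = dec-true (reachable? G _ _) ε

  reached⇒star : ∀ x → reached x ≡ true → Star (Adj G) (inj₁ u) x
  reached⇒star x = does-true (reachable? G _ x)

  -- Edges preserve the colour and vertices of equal colour are joined, so the colour class of `u`
  -- is exactly its component.
  part-unique : ∀ A B → Splits A B G → lookup A u ≡ true → A ≡ partˡ × B ≡ partʳ
  part-unique A B (respects , c) eu =
    trans (sym (Vec.tabulate∘lookup A)) (Vec.tabulate-cong (colour≡reached ∘ inj₁)) ,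
    trans (sym (Vec.tabulate∘lookup B)) (Vec.tabulate-cong (colour≡reached ∘ inj₂))
    where
    colour≡reached : ∀ x → colour A B x ≡ reached x
    colour≡reached x with reached x in e
    ... | true = trans (sym (colour-star A B G respects (reached⇒star x e))) eu
    ... | false with colour A B x in ex
    ...   | false = refl
    ...   | true  = trans (sym (dec-true (reachable? G _ x) (c (inj₁ u) x (trans eu (sym ex))))) e

  module _ (conn⁺ : Connected G⁺) (¬conn : ¬ Connected G) where

    ¬star-uv : ¬ Star (Adj G) (inj₁ u) (inj₂ v)
    ¬star-uv p = ¬conn (inj₁ u , λ x y → to-u x ◅◅ reverse G (to-u y))
      where
      to-u : ∀ x → Star (Adj G) x (inj₁ u)
      to-u x with reaches-end (proj₂ conn⁺ x (inj₁ u))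
      ... | inj₁ q = q
      ... | inj₂ q = q ◅◅ reverse G p

    -- By `reaches-end` every vertex is joined to u or v inside `G`; those not joined to u are
    -- therefore all joined to v and form one component.
    part-splits : Splits partˡ partʳ G
    part-splits = respects , star
      where
      reached-resp : ∀ x y → Adj G x y → reached x ≡ reached y
      reached-resp x y e with reached x in ex
      ... | true = sym (dec-true (reachable? G _ y) (reached⇒star x ex ◅◅ (e ◅ ε)))
      ... | false with reached y in ey
      ...   | false = refl
      ...   | true  = trans (sym ex) (dec-true (reachable? G _ x) (reached⇒star y ey ◅◅ (Adj-sym G {x} {y} e ◅ ε)))
      respects : Respects partˡ partʳ G
      respects x y e = trans (colour-part x) (trans (reached-resp x y e) (sym (colour-part y)))
      to-v : ∀ x → reached x ≡ false → Star (Adj G) x (inj₂ v)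
      to-v x e with reaches-end (proj₂ conn⁺ x (inj₁ u))
      ... | inj₂ q = q
      ... | inj₁ q with () ← trans (sym e) (dec-true (reachable? G _ x) (reverse G q))
      star′ : ∀ x y → reached x ≡ reached y → Star (Adj G) x y
      star′ x y e with reached x in ex
      ... | true  = reverse G (reached⇒star x ex) ◅◅ reached⇒star y (sym e)
      ... | false = to-v x ex ◅◅ reverse G (to-v y (sym e))
      star : ∀ x y → colour partˡ partʳ x ≡ colour partˡ partʳ y → Star (Adj G) x y
      star x y e = star′ x y (trans (sym (colour-part x)) (trans e (colour-part y)))

    part-u : lookup partˡ u ≡ true
    part-u = trans (colour-part (inj₁ u)) reached-u

    part-v : lookup partʳ v ≡ false
    part-v = trans (colour-part (inj₂ v)) (dec-false (reachable? G _ _) ¬star-uv)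

-- Counting edges and non-edges; edge insertion as a bijection

Sum-lookup : ∀ {n} (p : Subset n) → (Σ[ i ∈ allFin n ] χ (lookup p i)) ≡ card p
Sum-lookup []          = refl
Sum-lookup (true  ∷ p) = trans (Sum-allFin _ (χ ∘ lookup (true ∷ p))) (cong suc (Sum-lookup p))
Sum-lookup (false ∷ p) = trans (Sum-allFin _ (χ ∘ lookup (false ∷ p))) (Sum-lookup p)

Sum-lookup-not : ∀ {n} (p : Subset n) → (Σ[ i ∈ allFin n ] χ (not (lookup p i))) ≡ card (∁ p)
Sum-lookup-not p = trans (Sum-cong (allFin _) λ i → cong χ (sym (lookup-∁ p i))) (Sum-lookup (∁ p))

card-∁ : ∀ {n} (p : Subset n) → card p ℕ.+ card (∁ p) ≡ n
card-∁ []          = refl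
card-∁ (true  ∷ p) = cong suc (card-∁ p)
card-∁ (false ∷ p) = trans (ℕ.+-suc (card p) _) (cong suc (card-∁ p))

Sum-has : ∀ {r s} (G : BiGraph r s) → (Σ[ i ∈ allFin r ] Σ[ j ∈ allFin s ] χ (has G i j)) ≡ edges G
Sum-has {s = s} []      = refl
Sum-has {s = s} (p ∷ G) = trans (Sum-allFin _ (λ i → Σ[ j ∈ allFin s ] χ (has (p ∷ G) i j)))
                                (cong₂ ℕ._+_ (Sum-lookup p) (Sum-has G))

Sum-¬has : ∀ {r s} (G : BiGraph r s) →
  (Σ[ i ∈ allFin r ] Σ[ j ∈ allFin s ] χ (not (has G i j))) ℕ.+ edges G ≡ r ℕ.* s
Sum-¬has {s = s} []      = refl
Sum-¬has {suc r} {s} (p ∷ G) = begin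
  Sum (allFin (suc r)) f ℕ.+ (card p ℕ.+ edges G)
    ≡⟨ cong (ℕ._+ (card p ℕ.+ edges G)) (trans (Sum-allFin r f) (cong (ℕ._+ c) (Sum-lookup-not p))) ⟩
  card (∁ p) ℕ.+ c ℕ.+ (card p ℕ.+ edges G)
    ≡⟨ interchange (card (∁ p)) c (card p) (edges G) ⟩
  card (∁ p) ℕ.+ card p ℕ.+ (c ℕ.+ edges G)
    ≡⟨ cong₂ ℕ._+_ (trans (ℕ.+-comm (card (∁ p)) _) (card-∁ p)) (Sum-¬has G) ⟩
  s ℕ.+ r ℕ.* s ∎
  where
  f : Fin (suc r) → ℕ
  f i = Σ[ j ∈ allFin s ] χ (not (has (p ∷ G) i j))
  c = Sum (allFin r) (f ∘ suc)

edges-addEdge : ∀ {r s} u v (G : BiGraph r s) → has G u v ≡ false → edges (addEdge u v G) ≡ suc (edges G)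
edges-addEdge zero    v (p ∷ G) e = cong (ℕ._+ edges G) (card-insert p v e)
  where
  card-insert : ∀ {n} (p : Subset n) v → lookup p v ≡ false → card (p [ v ]≔ true) ≡ suc (card p)
  card-insert (false ∷ p) zero    e = refl
  card-insert (true  ∷ p) (suc v) e = cong suc (card-insert p v e)
  card-insert (false ∷ p) (suc v) e = card-insert p v e
edges-addEdge (suc u) v (p ∷ G) e = trans (cong (card p ℕ.+_) (edges-addEdge u v G e)) (ℕ.+-suc (card p) _)

-- Inserting v is a bijection from the sets that avoid v to the sets that contain it.
Sum-insert : ∀ {n} v (f : Subset n → ℕ) →
  (Σ[ p ∈ subsets n ] χ (lookup p v) ℕ.* f p) ≡ (Σ[ p ∈ subsets n ] χ (not (lookup p v)) ℕ.* f (p [ v ]≔ true))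
Sum-insert {suc n} zero f = begin
  (Σ[ p ∈ subsets (suc n) ] χ (lookup p zero) ℕ.* f p)
    ≡⟨ Sum-subsets n _ ⟩
  (Σ[ p ∈ subsets n ] 0) ℕ.+ (Σ[ p ∈ subsets n ] 1 ℕ.* f (true ∷ p))
    ≡⟨ ℕ.+-comm (Σ[ p ∈ subsets n ] 0) _ ⟩
  (Σ[ p ∈ subsets n ] 1 ℕ.* f (true ∷ p)) ℕ.+ (Σ[ p ∈ subsets n ] 0)
    ≡⟨ sym (Sum-subsets n _) ⟩
  (Σ[ p ∈ subsets (suc n) ] χ (not (lookup p zero)) ℕ.* f (p [ zero ]≔ true)) ∎
Sum-insert {suc n} (suc v) f = begin
  (Σ[ p ∈ subsets (suc n) ] χ (lookup p (suc v)) ℕ.* f p)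
    ≡⟨ Sum-subsets n _ ⟩
  _ ≡⟨ cong₂ ℕ._+_ (Sum-insert v (f ∘ (false ∷_))) (Sum-insert v (f ∘ (true ∷_))) ⟩
  _ ≡⟨ sym (Sum-subsets n _) ⟩
  (Σ[ p ∈ subsets (suc n) ] χ (not (lookup p (suc v))) ℕ.* f (p [ suc v ]≔ true)) ∎

-- Edge deletion as a change of the summation variable: each graph with the edge uv is `addEdge u v`
-- of exactly one graph without it.
Sum-addEdge : ∀ {r s} u v (f : BiGraph r s → ℕ) →
  (Σ[ G ∈ allBiGraphs r s ] χ (has G u v) ℕ.* f G)
    ≡ (Σ[ G ∈ allBiGraphs r s ] χ (not (has G u v)) ℕ.* f (addEdge u v G))
Sum-addEdge {suc r} {s} zero v f = begin
  (Σ[ G ∈ allBiGraphs (suc r) s ] χ (has G zero v) ℕ.* f G)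
    ≡⟨ Sum-graphs r s _ ⟩
  (Σ[ p ∈ subsets s ] Σ[ G ∈ allBiGraphs r s ] χ (lookup p v) ℕ.* f (p ∷ G))
    ≡⟨ Sum-cong (subsets s) (λ p → Sum-*ˡ (allBiGraphs r s) (χ (lookup p v)) (f ∘ (p ∷_))) ⟩
  (Σ[ p ∈ subsets s ] χ (lookup p v) ℕ.* (Σ[ G ∈ allBiGraphs r s ] f (p ∷ G)))
    ≡⟨ Sum-insert v _ ⟩
  (Σ[ p ∈ subsets s ] χ (not (lookup p v)) ℕ.* (Σ[ G ∈ allBiGraphs r s ] f ((p [ v ]≔ true) ∷ G)))
    ≡⟨ sym (Sum-cong (subsets s) (λ p → Sum-*ˡ (allBiGraphs r s) (χ (not (lookup p v))) (f ∘ ((p [ v ]≔ true) ∷_)))) ⟩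
  (Σ[ p ∈ subsets s ] Σ[ G ∈ allBiGraphs r s ] χ (not (lookup p v)) ℕ.* f ((p [ v ]≔ true) ∷ G))
    ≡⟨ sym (Sum-graphs r s _) ⟩
  (Σ[ G ∈ allBiGraphs (suc r) s ] χ (not (has G zero v)) ℕ.* f (addEdge zero v G)) ∎
Sum-addEdge {suc r} {s} (suc u) v f =
  trans (Sum-graphs r s _)
  (trans (Sum-cong (subsets s) λ p → Sum-addEdge u v (f ∘ (p ∷_)))
         (sym (Sum-graphs r s _)))

χ-*-0 : ∀ a b c → (a ≡ true → b ≡ false → c ≡ true → ⊥) → χ a ℕ.* (χ (not b) ℕ.* χ c) ≡ 0
χ-*-0 false b     c     h = refl
χ-*-0 true  true  c     h = refl
χ-*-0 true  false false h = refl
χ-*-0 true  false true  h = ⊥-elim (h refl refl refl)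

true≢false : true ≢ false
true≢false ()

module _ {r s : ℕ} (u : Fin r) (v : Fin s) (G : BiGraph r s) where

  -- The conditions on u and v orient the pair of components, so that a split is counted once and
  -- not also with the two sides exchanged.
  splitTerm : Subset r → Subset s → ℕ
  splitTerm A B = χ (lookup A u) ℕ.* (χ (not (lookup B v)) ℕ.* χ (splits A B G))

  private
    total : ℕ
    total = Σ[ A ∈ subsets r ] Σ[ B ∈ subsets s ] splitTerm A B

    no-split : (∀ A B → lookup A u ≡ true → lookup B v ≡ false → ¬ Splits A B G) → total ≡ 0
    no-split h = Sum-0 (subsets r) λ A → Sum-0 (subsets s) λ B →
      χ-*-0 (lookup A u) (lookup B v) (splits A B G) λ eu ev e → h A B eu ev (splits⇒Splits A B G e)

    one-split : Connected (addEdge u v G) → ¬ Connected G → total ≡ 1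
    one-split conn⁺ ¬conn = begin
      total
        ≡⟨ Sum-subsets-unique A₀ _ (λ A ne → Sum-0 (subsets s) λ B → absent A B (λ eq _ → ne eq)) ⟩
      (Σ[ B ∈ subsets s ] splitTerm A₀ B)
        ≡⟨ Sum-subsets-unique B₀ _ (λ B ne → absent A₀ B (λ _ eq → ne eq)) ⟩
      splitTerm A₀ B₀
        ≡⟨ cong₂ (λ a b → χ a ℕ.* (χ (not b) ℕ.* χ (splits A₀ B₀ G))) eu ev ⟩
      1 ℕ.* (1 ℕ.* χ (splits A₀ B₀ G))
        ≡⟨ cong (λ c → 1 ℕ.* (1 ℕ.* χ c))
             (Splits⇒splits A₀ B₀ G (part-splits u v G conn⁺ ¬conn) (inj₁ u) (inj₂ v) eu ev) ⟩
      1 ∎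
      where
      A₀ = partˡ u v G
      B₀ = partʳ u v G
      eu = part-u u v G conn⁺ ¬conn
      ev = part-v u v G conn⁺ ¬conn
      absent : ∀ A B → (A ≡ A₀ → B ≡ B₀ → ⊥) → splitTerm A B ≡ 0
      absent A B ne = χ-*-0 (lookup A u) (lookup B v) (splits A B G) λ eu _ e →
        let eqA , eqB = part-unique u v G A B (splits⇒Splits A B G e) eu in ne eqA eqB

  -- The only possible nonzero term of the double sum is the one where A ⊔ B is the component of u in G.
  conn-addEdge : χ (not (has G u v)) ℕ.* χ (conn (addEdge u v G))
                 ≡ χ (not (has G u v)) ℕ.* χ (conn G)
                   ℕ.+ (Σ[ A ∈ subsets r ] Σ[ B ∈ subsets s ] splitTerm A B)
  conn-addEdge with has G u v in e | conn G in c | conn (addEdge u v G) in c⁺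
  ... | true | _ | _ = sym (no-split λ A B eu ev sp →
    true≢false (trans (sym eu) (trans (proj₁ sp (inj₁ u) (inj₂ v) (has⇒Adj G e)) ev)))
  ... | false | true | true = cong suc (sym (no-split λ A B eu ev sp →
    true≢false (trans (sym eu) (trans (colour-star A B G (proj₁ sp) (proj₂ (conn⇒Connected G c) (inj₁ u) (inj₂ v))) ev))))
  ... | false | true | false =
    ⊥-elim (true≢false (trans (sym (Connected⇒conn (addEdge u v G) (Connected-addEdge u v G (conn⇒Connected G c)))) c⁺))
  -- Here uv is a bridge of the enlarged graph; this is the only case with a nonzero split term.
  ... | false | false | true = sym (one-split (conn⇒Connected (addEdge u v G) c⁺)
    λ c′ → true≢false (trans (sym (Connected⇒conn G c′)) c))
  ... | false | false | false = sym (no-split λ A B eu ev sp →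
    true≢false (trans (sym (Connected⇒conn (addEdge u v G) (Splits⇒Connected-addEdge u v G A B sp eu ev))) c⁺))

-- Counting pairs of a connected graph and an edge

-- connCount r s n: the number of connected graphs with n - 1 edges.
connCount : ℕ → ℕ → ℕ → ℕ
connCount r s n = Σ[ G ∈ allBiGraphs r s ] χ (conn G) ℕ.* δ (suc (edges G)) n

-- Each graph enters with its number of edges plus one, as in `connCount`; for connected graphs the
-- index n is then the number of vertices plus the sum of the two excesses.
pairWeight : ∀ {i j i′ j′} → ℕ → BiGraph i j → BiGraph i′ j′ → ℕ
pairWeight n G₁ G₂ = χ (conn G₁) ℕ.* χ (conn G₂) ℕ.* δ (suc (edges G₁) ℕ.+ suc (edges G₂)) n

pairCount : ℕ → ℕ → ℕ → ℕ → ℕ → ℕ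
pairCount i j i′ j′ n = Σ[ G₁ ∈ allBiGraphs i j ] Σ[ G₂ ∈ allBiGraphs i′ j′ ] pairWeight n G₁ G₂

Sum-splits : ∀ {r s} (A : Subset r) (B : Subset s) e →
  (Σ[ G ∈ allBiGraphs r s ] χ (splits A B G) ℕ.* δ (edges G) e)
    ≡ pairCount (card A) (card B) (card (∁ A)) (card (∁ B)) (suc (suc e))
Sum-splits {r} {s} A B e = trans (Sum-cong (allBiGraphs r s) weight)
                                 (Sum-separated A B (pairWeight (suc (suc e))))
  where
  weight : ∀ G → χ (splits A B G) ℕ.* δ (edges G) e
           ≡ χ (separates A B G) ℕ.* pairWeight (suc (suc e)) (induced A B G) (induced (∁ A) (∁ B) G)
  weight G with separates A B G in eq
  ... | false = refl
  ... | true  = begin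
    χ (c₁ ∧ c₂) ℕ.* δ (edges G) e
      ≡⟨ cong₂ (λ x y → x ℕ.* δ y e) (χ-∧ c₁ c₂) (edges-separated A B G eq) ⟩
    χ c₁ ℕ.* χ c₂ ℕ.* δ (suc (edges G₁ ℕ.+ edges G₂)) (suc e)
      ≡⟨ cong (λ y → χ c₁ ℕ.* χ c₂ ℕ.* δ y (suc e)) (sym (ℕ.+-suc (edges G₁) (edges G₂))) ⟩
    pairWeight (suc (suc e)) G₁ G₂
      ≡⟨ sym (ℕ.*-identityˡ _) ⟩
    1 ℕ.* pairWeight (suc (suc e)) G₁ G₂ ∎
    where
    G₁ = induced A B G
    G₂ = induced (∁ A) (∁ B) G
    c₁ = conn G₁
    c₂ = conn G₂

module _ (r s e : ℕ) where

  private
    graphs = allBiGraphs r s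

    w : BiGraph r s → ℕ
    w G = δ (edges G) e

    κ : Subset r → Subset s → ℕ
    κ A B = pairCount (card A) (card B) (card (∁ A)) (card (∁ B)) (suc (suc e))

    Σᵤᵥ : (Fin r → Fin s → ℕ) → ℕ
    Σᵤᵥ f = Σ[ u ∈ allFin r ] Σ[ v ∈ allFin s ] f u v

    Σᵤᵥ-cong : ∀ {f g : Fin r → Fin s → ℕ} → (∀ u v → f u v ≡ g u v) → Σᵤᵥ f ≡ Σᵤᵥ g
    Σᵤᵥ-cong h = Sum-cong (allFin r) λ u → Sum-cong (allFin s) (h u)

    Σᵤᵥ-*ˡ : ∀ c f → Σᵤᵥ (λ u v → c ℕ.* f u v) ≡ c ℕ.* Σᵤᵥ f
    Σᵤᵥ-*ˡ c f = trans (Sum-cong (allFin r) λ u → Sum-*ˡ (allFin s) c (f u)) (Sum-*ˡ (allFin r) c _)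

    Σᵤᵥ-swap : ∀ (xs : List X) (f : X → Fin r → Fin s → ℕ) → (Σ[ x ∈ xs ] Σᵤᵥ (f x)) ≡ Σᵤᵥ (λ u v → Σ[ x ∈ xs ] f x u v)
    Σᵤᵥ-swap xs f = trans (Sum-swap xs (allFin r) λ x u → Σ[ v ∈ allFin s ] f x u v)
      (Sum-cong (allFin r) λ u → Sum-swap xs (allFin s) λ x v → f x u v)

    remaining splitting : Fin r → Fin s → ℕ
    remaining u v = Σ[ G ∈ graphs ] χ (not (has G u v)) ℕ.* χ (conn G) ℕ.* w G
    splitting u v = Σ[ A ∈ subsets r ] Σ[ B ∈ subsets s ] χ (lookup A u) ℕ.* (χ (not (lookup B v)) ℕ.* κ A B)

    -- Weighting each graph by its number of edges turns the sum into one over graphs with a marked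
    -- edge uv.
    mark-edge : suc e ℕ.* connCount r s (suc (suc e))
                ≡ Σᵤᵥ (λ u v → Σ[ G ∈ graphs ] χ (has G u v) ℕ.* (χ (conn G) ℕ.* δ (edges G) (suc e)))
    mark-edge = begin
      suc e ℕ.* connCount r s (suc (suc e))
        ≡⟨ sym (Sum-*ˡ graphs (suc e) _) ⟩
      (Σ[ G ∈ graphs ] suc e ℕ.* (χ (conn G) ℕ.* δ (edges G) (suc e)))
        ≡⟨ Sum-cong graphs (λ G → weight (χ (conn G)) (edges G)) ⟩
      (Σ[ G ∈ graphs ] χ (conn G) ℕ.* δ (edges G) (suc e) ℕ.* edges G)
        ≡⟨ Sum-cong graphs (λ G → trans (cong (χ (conn G) ℕ.* δ (edges G) (suc e) ℕ.*_) (sym (Sum-has G)))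
             (sym (Σᵤᵥ-*ˡ (χ (conn G) ℕ.* δ (edges G) (suc e)) _))) ⟩
      (Σ[ G ∈ graphs ] Σᵤᵥ (λ u v → χ (conn G) ℕ.* δ (edges G) (suc e) ℕ.* χ (has G u v)))
        ≡⟨ Σᵤᵥ-swap graphs _ ⟩
      Σᵤᵥ (λ u v → Σ[ G ∈ graphs ] χ (conn G) ℕ.* δ (edges G) (suc e) ℕ.* χ (has G u v))
        ≡⟨ Σᵤᵥ-cong (λ u v → Sum-cong graphs λ G → ℕ.*-comm _ (χ (has G u v))) ⟩
      Σᵤᵥ (λ u v → Σ[ G ∈ graphs ] χ (has G u v) ℕ.* (χ (conn G) ℕ.* δ (edges G) (suc e))) ∎
      where
      open ℕ-Solver.+-*-Solver
      weight : ∀ c m → suc e ℕ.* (c ℕ.* δ m (suc e)) ≡ c ℕ.* δ m (suc e) ℕ.* m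
      weight c m = begin
        suc e ℕ.* (c ℕ.* δ m (suc e)) ≡⟨ solve 3 (λ a b c → a :* (b :* c) := b :* (c :* a)) refl (suc e) c (δ m (suc e)) ⟩
        c ℕ.* (δ m (suc e) ℕ.* suc e) ≡⟨ cong (c ℕ.*_) (δ-*-comm m (suc e)) ⟩
        c ℕ.* (δ m (suc e) ℕ.* m)     ≡⟨ sym (ℕ.*-assoc c _ m) ⟩
        c ℕ.* δ m (suc e) ℕ.* m       ∎

    delete-edge : ∀ u v → (Σ[ G ∈ graphs ] χ (has G u v) ℕ.* (χ (conn G) ℕ.* δ (edges G) (suc e)))
                          ≡ remaining u v ℕ.+ splitting u v
    delete-edge u v = begin
      (Σ[ G ∈ graphs ] χ (has G u v) ℕ.* (χ (conn G) ℕ.* δ (edges G) (suc e)))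
        ≡⟨ Sum-addEdge u v _ ⟩
      (Σ[ G ∈ graphs ] χ (not (has G u v)) ℕ.* (χ (conn (addEdge u v G)) ℕ.* δ (edges (addEdge u v G)) (suc e)))
        ≡⟨ Sum-cong graphs step ⟩
      (Σ[ G ∈ graphs ] χ (not (has G u v)) ℕ.* χ (conn G) ℕ.* w G
         ℕ.+ (Σ[ A ∈ subsets r ] Σ[ B ∈ subsets s ] splitTerm u v G A B) ℕ.* w G)
        ≡⟨ Sum-+ graphs _ _ ⟩
      remaining u v ℕ.+ (Σ[ G ∈ graphs ] (Σ[ A ∈ subsets r ] Σ[ B ∈ subsets s ] splitTerm u v G A B) ℕ.* w G)
        ≡⟨ cong (remaining u v ℕ.+_) split ⟩
      remaining u v ℕ.+ splitting u v ∎
      where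
      step : ∀ G → χ (not (has G u v)) ℕ.* (χ (conn (addEdge u v G)) ℕ.* δ (edges (addEdge u v G)) (suc e))
                   ≡ χ (not (has G u v)) ℕ.* χ (conn G) ℕ.* w G
                     ℕ.+ (Σ[ A ∈ subsets r ] Σ[ B ∈ subsets s ] splitTerm u v G A B) ℕ.* w G
      step G = begin
        χ (not (has G u v)) ℕ.* (χ (conn (addEdge u v G)) ℕ.* δ (edges (addEdge u v G)) (suc e))
          ≡⟨ sym (ℕ.*-assoc (χ (not (has G u v))) _ _) ⟩
        χ (not (has G u v)) ℕ.* χ (conn (addEdge u v G)) ℕ.* δ (edges (addEdge u v G)) (suc e)
          ≡⟨ count (has G u v) refl ⟩
        χ (not (has G u v)) ℕ.* χ (conn (addEdge u v G)) ℕ.* w G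
          ≡⟨ cong (ℕ._* w G) (conn-addEdge u v G) ⟩
        (χ (not (has G u v)) ℕ.* χ (conn G) ℕ.+ (Σ[ A ∈ subsets r ] Σ[ B ∈ subsets s ] splitTerm u v G A B)) ℕ.* w G
          ≡⟨ ℕ.*-distribʳ-+ (w G) (χ (not (has G u v)) ℕ.* χ (conn G)) _ ⟩
        _ ∎
        where
        -- If uv is already present the factor in front vanishes; otherwise the insertion raises the
        -- number of edges by exactly one.
        count : ∀ b → has G u v ≡ b → χ (not b) ℕ.* χ (conn (addEdge u v G)) ℕ.* δ (edges (addEdge u v G)) (suc e)
                                      ≡ χ (not b) ℕ.* χ (conn (addEdge u v G)) ℕ.* w G
        count true  _ = refl
        count false h = cong (λ m → 1 ℕ.* χ (conn (addEdge u v G)) ℕ.* δ m (suc e)) (edges-addEdge u v G h)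
      split : (Σ[ G ∈ graphs ] (Σ[ A ∈ subsets r ] Σ[ B ∈ subsets s ] splitTerm u v G A B) ℕ.* w G) ≡ splitting u v
      split = begin
        (Σ[ G ∈ graphs ] (Σ[ A ∈ subsets r ] Σ[ B ∈ subsets s ] splitTerm u v G A B) ℕ.* w G)
          ≡⟨ Sum-cong graphs (λ G → trans (sym (Sum-*ʳ (subsets r) (w G) _))
               (Sum-cong (subsets r) λ A → sym (Sum-*ʳ (subsets s) (w G) (splitTerm u v G A)))) ⟩
        (Σ[ G ∈ graphs ] Σ[ A ∈ subsets r ] Σ[ B ∈ subsets s ] splitTerm u v G A B ℕ.* w G)
          ≡⟨ Sum-swap graphs (subsets r) _ ⟩
        (Σ[ A ∈ subsets r ] Σ[ G ∈ graphs ] Σ[ B ∈ subsets s ] splitTerm u v G A B ℕ.* w G)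
          ≡⟨ Sum-cong (subsets r) (λ A → Sum-swap graphs (subsets s) _) ⟩
        (Σ[ A ∈ subsets r ] Σ[ B ∈ subsets s ] Σ[ G ∈ graphs ] splitTerm u v G A B ℕ.* w G)
          ≡⟨ Sum-cong (subsets r) (λ A → Sum-cong (subsets s) λ B → inner A B) ⟩
        splitting u v ∎
        where
        inner : ∀ A B → (Σ[ G ∈ graphs ] splitTerm u v G A B ℕ.* w G)
                        ≡ χ (lookup A u) ℕ.* (χ (not (lookup B v)) ℕ.* κ A B)
        inner A B = begin
          (Σ[ G ∈ graphs ] a ℕ.* (b ℕ.* χ (splits A B G)) ℕ.* w G)
            ≡⟨ Sum-cong graphs (λ G → solve 4 (λ a b c d → (a :* (b :* c)) :* d := (a :* b) :* (c :* d)) refl a b (χ (splits A B G)) (w G)) ⟩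
          (Σ[ G ∈ graphs ] a ℕ.* b ℕ.* (χ (splits A B G) ℕ.* w G))
            ≡⟨ Sum-*ˡ graphs (a ℕ.* b) _ ⟩
          a ℕ.* b ℕ.* (Σ[ G ∈ graphs ] χ (splits A B G) ℕ.* w G)
            ≡⟨ cong (a ℕ.* b ℕ.*_) (Sum-splits A B e) ⟩
          a ℕ.* b ℕ.* κ A B
            ≡⟨ ℕ.*-assoc a b _ ⟩
          a ℕ.* (b ℕ.* κ A B) ∎
          where
          open ℕ-Solver.+-*-Solver
          a = χ (lookup A u)
          b = χ (not (lookup B v))

    -- A connected graph with e edges has r s - e non-edges; the term with factor e makes up the
    -- difference without subtraction.
    sum-remaining : Σᵤᵥ remaining ℕ.+ e ℕ.* connCount r s (suc e) ≡ r ℕ.* s ℕ.* connCount r s (suc e)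
    sum-remaining = begin
      Σᵤᵥ remaining ℕ.+ e ℕ.* connCount r s (suc e)
        ≡⟨ cong₂ ℕ._+_ (sym (Σᵤᵥ-swap graphs _)) (sym (Sum-*ˡ graphs e _)) ⟩
      (Σ[ G ∈ graphs ] Σᵤᵥ (λ u v → χ (not (has G u v)) ℕ.* χ (conn G) ℕ.* w G))
        ℕ.+ (Σ[ G ∈ graphs ] e ℕ.* (χ (conn G) ℕ.* w G))
        ≡⟨ sym (Sum-+ graphs _ _) ⟩
      (Σ[ G ∈ graphs ] Σᵤᵥ (λ u v → χ (not (has G u v)) ℕ.* χ (conn G) ℕ.* w G) ℕ.+ e ℕ.* (χ (conn G) ℕ.* w G))
        ≡⟨ Sum-cong graphs weight ⟩
      (Σ[ G ∈ graphs ] r ℕ.* s ℕ.* (χ (conn G) ℕ.* w G))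
        ≡⟨ Sum-*ˡ graphs (r ℕ.* s) _ ⟩
      r ℕ.* s ℕ.* connCount r s (suc e) ∎
      where
      weight : ∀ G → Σᵤᵥ (λ u v → χ (not (has G u v)) ℕ.* χ (conn G) ℕ.* w G) ℕ.+ e ℕ.* (χ (conn G) ℕ.* w G)
                     ≡ r ℕ.* s ℕ.* (χ (conn G) ℕ.* w G)
      weight G = begin
        Σᵤᵥ (λ u v → χ (not (has G u v)) ℕ.* c ℕ.* w G) ℕ.+ e ℕ.* (c ℕ.* w G)
          ≡⟨ cong (ℕ._+ e ℕ.* (c ℕ.* w G)) (trans
               (Σᵤᵥ-cong λ u v → solve 3 (λ h c w → (h :* c) :* w := (c :* w) :* h) refl (χ (not (has G u v))) c (w G))
               (Σᵤᵥ-*ˡ (c ℕ.* w G) _)) ⟩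
        c ℕ.* w G ℕ.* m ℕ.+ e ℕ.* (c ℕ.* w G)
          ≡⟨ solve 4 (λ c w m e → (c :* w) :* m :+ e :* (c :* w) := (c :* w) :* m :+ c :* (w :* e)) refl c (w G) m e ⟩
        c ℕ.* w G ℕ.* m ℕ.+ c ℕ.* (w G ℕ.* e)
          ≡⟨ cong (λ z → c ℕ.* w G ℕ.* m ℕ.+ c ℕ.* z) (δ-*-comm (edges G) e) ⟩
        c ℕ.* w G ℕ.* m ℕ.+ c ℕ.* (w G ℕ.* edges G)
          ≡⟨ solve 4 (λ c w m e → (c :* w) :* m :+ c :* (w :* e) := (m :+ e) :* (c :* w)) refl c (w G) m (edges G) ⟩
        (m ℕ.+ edges G) ℕ.* (c ℕ.* w G)
          ≡⟨ cong (ℕ._* (c ℕ.* w G)) (Sum-¬has G) ⟩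
        r ℕ.* s ℕ.* (c ℕ.* w G) ∎
        where
        open ℕ-Solver.+-*-Solver
        c = χ (conn G)
        m = Σᵤᵥ (λ u v → χ (not (has G u v)))

    -- The pair u, v enters only through u ∈ A and v ∉ B, which leaves `card A` choices of u and
    -- `card (∁ B)` choices of v.
    sum-splitting : Σᵤᵥ splitting ≡ (Σ[ A ∈ subsets r ] Σ[ B ∈ subsets s ] card A ℕ.* (card (∁ B) ℕ.* κ A B))
    sum-splitting = trans (Sum-swap² (allFin r) (allFin s) (subsets r) (subsets s) _)
      (Sum-cong (subsets r) λ A → Sum-cong (subsets s) λ B → inner A B)
      where
      inner : ∀ A B → Σᵤᵥ (λ u v → χ (lookup A u) ℕ.* (χ (not (lookup B v)) ℕ.* κ A B)) ≡ card A ℕ.* (card (∁ B) ℕ.* κ A B)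
      inner A B = begin
        Σᵤᵥ (λ u v → χ (lookup A u) ℕ.* (χ (not (lookup B v)) ℕ.* κ A B))
          ≡⟨ Sum-cong (allFin r) (λ u → Sum-*ˡ (allFin s) (χ (lookup A u)) _) ⟩
        (Σ[ u ∈ allFin r ] χ (lookup A u) ℕ.* (Σ[ v ∈ allFin s ] χ (not (lookup B v)) ℕ.* κ A B))
          ≡⟨ Sum-*ʳ (allFin r) _ _ ⟩
        (Σ[ u ∈ allFin r ] χ (lookup A u)) ℕ.* (Σ[ v ∈ allFin s ] χ (not (lookup B v)) ℕ.* κ A B)
          ≡⟨ cong₂ ℕ._*_ (Sum-lookup A) (trans (Sum-*ʳ (allFin s) (κ A B) _) (cong (ℕ._* κ A B) (Sum-lookup-not B))) ⟩
        card A ℕ.* (card (∁ B) ℕ.* κ A B) ∎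

  edge-count : suc e ℕ.* connCount r s (suc (suc e)) ℕ.+ e ℕ.* connCount r s (suc e)
               ≡ r ℕ.* s ℕ.* connCount r s (suc e)
                 ℕ.+ (Σ[ A ∈ subsets r ] Σ[ B ∈ subsets s ] card A ℕ.* (card (∁ B) ℕ.* κ A B))
  edge-count = begin
    suc e ℕ.* connCount r s (suc (suc e)) ℕ.+ e ℕ.* connCount r s (suc e)
      ≡⟨ cong (ℕ._+ e ℕ.* connCount r s (suc e)) (trans mark-edge (trans (Σᵤᵥ-cong delete-edge) sum-+)) ⟩
    Σᵤᵥ remaining ℕ.+ Σᵤᵥ splitting ℕ.+ e ℕ.* connCount r s (suc e)
      ≡⟨ solve 3 (λ a b c → (a :+ b) :+ c := (a :+ c) :+ b) refl (Σᵤᵥ remaining) (Σᵤᵥ splitting) _ ⟩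
    Σᵤᵥ remaining ℕ.+ e ℕ.* connCount r s (suc e) ℕ.+ Σᵤᵥ splitting
      ≡⟨ cong₂ ℕ._+_ sum-remaining sum-splitting ⟩
    _ ∎
    where
    open ℕ-Solver.+-*-Solver
    sum-+ : Σᵤᵥ (λ u v → remaining u v ℕ.+ splitting u v) ≡ Σᵤᵥ remaining ℕ.+ Σᵤᵥ splitting
    sum-+ = trans (Sum-cong (allFin r) λ u → Sum-+ (allFin s) _ _) (Sum-+ (allFin r) _ _)

-- Connected graphs have at least r + s - 1 edges

delete : ∀ {n} (p : Subset n) v → lookup p v ≡ true → ∃[ q ] lookup q v ≡ false × q [ v ]≔ true ≡ p
delete (true ∷ p) zero    e = false ∷ p , refl , refl
delete (x ∷ p)    (suc v) e with q , h , refl ← delete p v e = x ∷ q , h , refl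

deleteEdge : ∀ {r s} u v (G : BiGraph r s) → has G u v ≡ true → ∃[ H ] has H u v ≡ false × addEdge u v H ≡ G
deleteEdge zero    v (p ∷ G) e with q , h , refl ← delete p v e = q ∷ G , h , refl
deleteEdge (suc u) v (p ∷ G) e with H , h , refl ← deleteEdge u v G e = p ∷ H , h , refl

single-vertex : ∀ r s → (∀ (x y : Vertex r s) → x ≡ y) → r ℕ.+ s ℕ.≤ 1
single-vertex zero          zero          h = z≤n
single-vertex zero          (suc zero)    h = s≤s z≤n
single-vertex zero          (suc (suc s)) h with () ← h (inj₂ zero) (inj₂ (suc zero))
single-vertex (suc zero)    zero          h = s≤s z≤n
single-vertex (suc zero)    (suc s)       h with () ← h (inj₁ zero) (inj₂ zero)
single-vertex (suc (suc r)) s             h with () ← h (inj₁ zero) (inj₁ (suc zero))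

-- Delete some edge uv. If the rest is connected, the induction hypothesis applies to it; if not, it
-- falls into the components of u and v, and the two inequalities add up, the deleted edge paying
-- for the second 1. The bound n carries the induction, since the parts are not structurally smaller
-- than G.
vertices≤edges : ∀ n {r s} (G : BiGraph r s) → edges G ℕ.≤ n → Connected G → r ℕ.+ s ℕ.≤ suc (edges G)
vertices≤edges n {r} {s} G le (x₀ , c) with Fin.any? (λ u → Fin.any? λ v → has G u v Bool.≟ true)
... | no edgeless = ℕ.≤-trans (single-vertex r s λ x y → collapse (c x y)) (s≤s z≤n)
  where
  collapse : ∀ {x y} → Star (Adj G) x y → x ≡ y
  collapse ε = refl
  collapse (_◅_ {inj₁ u} {inj₂ v} e _) = ⊥-elim (edgeless (u , v , Adj⇒has G e))
  collapse (_◅_ {inj₂ v} {inj₁ u} e _) = ⊥-elim (edgeless (u , v , Adj⇒has G e))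
... | yes (u , v , e) with H , h , refl ← deleteEdge u v G e
  rewrite edges-addEdge u v H h with n | le
... | suc n′ | s≤s le′ with connected? H
...   | yes c′ = ℕ.m≤n⇒m≤1+n (vertices≤edges n′ H le′ c′)
...   | no ¬c  = subst₂ ℕ._≤_ vertex-sum edge-sum
    (ℕ.+-mono-≤ (vertices≤edges n′ H₁ (ℕ.≤-trans (ℕ.m≤m+n _ _) le″) (Splits⇒Connectedˡ A B H sp (inj₁ u) eu))
                (vertices≤edges n′ H₂ (ℕ.≤-trans (ℕ.m≤n+m _ _) le″) (Splits⇒Connectedʳ A B H sp (inj₂ v) ev)))
  where
  A  = partˡ u v H
  B  = partʳ u v H
  H₁ = induced A B H
  H₂ = induced (∁ A) (∁ B) H
  sp = part-splits u v H (x₀ , c) ¬c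
  eu = part-u u v H (x₀ , c) ¬c
  ev = part-v u v H (x₀ , c) ¬c
  es : edges H ≡ edges H₁ ℕ.+ edges H₂
  es = edges-separated A B H (Splits⇒separates A B H sp)
  le″ = subst (ℕ._≤ n′) es le′
  vertex-sum : card A ℕ.+ card B ℕ.+ (card (∁ A) ℕ.+ card (∁ B)) ≡ r ℕ.+ s
  vertex-sum = trans (interchange (card A) _ _ _) (cong₂ ℕ._+_ (card-∁ A) (card-∁ B))
  edge-sum : suc (edges H₁) ℕ.+ suc (edges H₂) ≡ suc (suc (edges H))
  edge-sum = cong suc (trans (ℕ.+-suc (edges H₁) _) (cong suc (sym es)))

-- The number a is the excess, in the role of the third argument of `Nbi`.
conn-excess : ∀ {r s} (G : BiGraph r s) → conn G ≡ true → ∃[ a ] suc (edges G) ≡ r ℕ.+ s ℕ.+ a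
conn-excess G e with ℕ.m≤n⇒∃[o]m+o≡n (vertices≤edges (edges G) G ℕ.≤-refl (conn⇒Connected G e))
... | a , eq = a , sym eq

-- The graphs counted here would have r + s - 2 edges, one fewer than a tree. This is what justifies
-- the zero series at k = -1.
connCount-below : ∀ r s n → suc n ≡ r ℕ.+ s → connCount r s n ≡ 0
connCount-below r s n eq = Sum-0 (allBiGraphs r s) zero-term
  where
  zero-term : ∀ (G : BiGraph r s) → χ (conn G) ℕ.* δ (suc (edges G)) n ≡ 0
  zero-term G with conn G in c
  ... | false = refl
  ... | true with a , ea ← conn-excess G c
    rewrite ea | sym eq | sym (ℕ.+-suc n a) = trans (ℕ.+-identityʳ _)
      (trans (cong (δ (n ℕ.+ suc a)) (sym (ℕ.+-identityʳ n))) (δ-+ˡ n (suc a) 0))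

connCount-0 : ∀ r s → connCount r s 0 ≡ 0
connCount-0 r s = Sum-0 (allBiGraphs r s) λ G → ℕ.*-zeroʳ (χ (conn G))

-- The numbers `Nbi` in terms of `connCount`

length-filter : ∀ {P : X → Set} (P? : Decidable P) (f : X → ℕ) → (∀ x → χ (does (P? x)) ≡ f x) →
                ∀ xs → length (filter P? xs) ≡ Sum xs f
length-filter P? f h []       = refl
length-filter P? f h (x ∷ xs) with does (P? x) | h x
... | true  | e = cong₂ ℕ._+_ e (length-filter P? f h xs)
... | false | e = cong₂ ℕ._+_ e (length-filter P? f h xs)

-- Moving the -1 across turns the integer condition on the edges into one over ℕ, valid even when r
-- + s + m = 0.
Nbi≡connCount : ∀ r s m → Nbi r s (+ m) ≡ connCount r s (r ℕ.+ s ℕ.+ m)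
Nbi≡connCount r s m = length-filter (counted? (+ m)) _ indicator (allBiGraphs r s)
  where
  n = r ℕ.+ s ℕ.+ m
  indicator : ∀ (G : BiGraph r s) → χ (does (counted? (+ m) G)) ≡ χ (conn G) ℕ.* δ (suc (edges G)) n
  indicator G = begin
    χ (does (connected? G) ∧ does (+ edges G ℤ.≟ + r ℤ.+ + s ℤ.+ + m ℤ.- ℤ.1ℤ))
      ≡⟨ cong₂ (λ a b → χ (a ∧ b)) (sym (conn≡does G)) (does-⇔ (mk⇔ to from) (+ edges G ℤ.≟ + n ℤ.- ℤ.1ℤ) (suc (edges G) ℕ.≟ n)) ⟩
    χ (conn G ∧ (suc (edges G) ≡ᵇ n))
      ≡⟨ χ-∧ (conn G) _ ⟩
    χ (conn G) ℕ.* δ (suc (edges G)) n ∎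
    where
    to : + edges G ≡ + n ℤ.- ℤ.1ℤ → suc (edges G) ≡ n
    to e = trans (ℕ.+-comm 1 (edges G)) (ℤ.+-injective
      (trans (cong (ℤ._+ ℤ.1ℤ) e) (trans (ℤ.+-assoc (+ n) ℤ.-1ℤ ℤ.1ℤ) (ℤ.+-identityʳ (+ n)))))
    from : suc (edges G) ≡ n → + edges G ≡ + n ℤ.- ℤ.1ℤ
    from e = cong (λ z → + z ℤ.- ℤ.1ℤ) e

-- By vertices≤edges both excesses are nonnegative, so they may be distributed over l + l′ = m.
pairCount-anti : ∀ i j i′ j′ m → pairCount i j i′ j′ (i ℕ.+ j ℕ.+ (i′ ℕ.+ j′) ℕ.+ m)
                 ≡ anti m (λ l l′ → Nbi i j (+ l) ℕ.* Nbi i′ j′ (+ l′))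
pairCount-anti i j i′ j′ m = begin
  (Σ[ G₁ ∈ gs₁ ] Σ[ G₂ ∈ gs₂ ] pairWeight (p ℕ.+ q ℕ.+ m) G₁ G₂)
    ≡⟨ Sum-cong gs₁ (λ G₁ → Sum-cong gs₂ λ G₂ → weight G₁ G₂) ⟩
  (Σ[ G₁ ∈ gs₁ ] Σ[ G₂ ∈ gs₂ ] anti m (λ l l′ → f₁ l G₁ ℕ.* f₂ l′ G₂))
    ≡⟨ Sum-cong gs₁ (λ G₁ → Sum-anti gs₂ m _) ⟩
  (Σ[ G₁ ∈ gs₁ ] anti m (λ l l′ → Σ[ G₂ ∈ gs₂ ] f₁ l G₁ ℕ.* f₂ l′ G₂))
    ≡⟨ Sum-anti gs₁ m _ ⟩
  anti m (λ l l′ → Σ[ G₁ ∈ gs₁ ] Σ[ G₂ ∈ gs₂ ] f₁ l G₁ ℕ.* f₂ l′ G₂)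
    ≡⟨ anti-cong m (λ l l′ _ → trans
         (trans (Sum-cong gs₁ λ G₁ → Sum-*ˡ gs₂ (f₁ l G₁) (f₂ l′)) (Sum-*ʳ gs₁ _ (f₁ l)))
         (sym (cong₂ ℕ._*_ (Nbi≡connCount i j l) (Nbi≡connCount i′ j′ l′)))) ⟩
  anti m (λ l l′ → Nbi i j (+ l) ℕ.* Nbi i′ j′ (+ l′)) ∎
  where
  p = i ℕ.+ j
  q = i′ ℕ.+ j′
  gs₁ = allBiGraphs i j
  gs₂ = allBiGraphs i′ j′
  f₁ : ℕ → BiGraph i j → ℕ
  f₁ l G = χ (conn G) ℕ.* δ (suc (edges G)) (p ℕ.+ l)
  f₂ : ℕ → BiGraph i′ j′ → ℕ
  f₂ l G = χ (conn G) ℕ.* δ (suc (edges G)) (q ℕ.+ l)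
  distribute : ∀ {x y} → ∃[ a ] x ≡ p ℕ.+ a → ∃[ b ] y ≡ q ℕ.+ b →
    1 ℕ.* δ (x ℕ.+ y) (p ℕ.+ q ℕ.+ m) ≡ anti m (λ l l′ → 1 ℕ.* δ x (p ℕ.+ l) ℕ.* (1 ℕ.* δ y (q ℕ.+ l′)))
  distribute (a , refl) (b , refl) = begin
    1 ℕ.* δ (p ℕ.+ a ℕ.+ (q ℕ.+ b)) (p ℕ.+ q ℕ.+ m)
      ≡⟨ ℕ.*-identityˡ _ ⟩
    δ (p ℕ.+ a ℕ.+ (q ℕ.+ b)) (p ℕ.+ q ℕ.+ m)
      ≡⟨ cong (λ z → δ z (p ℕ.+ q ℕ.+ m)) (interchange p a q b) ⟩
    δ (p ℕ.+ q ℕ.+ (a ℕ.+ b)) (p ℕ.+ q ℕ.+ m)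
      ≡⟨ δ-+ˡ (p ℕ.+ q) (a ℕ.+ b) m ⟩
    δ (a ℕ.+ b) m
      ≡⟨ sym (anti-δ m a b) ⟩
    anti m (λ l l′ → δ a l ℕ.* δ b l′)
      ≡⟨ anti-cong m (λ l l′ _ → sym (cong₂ ℕ._*_
           (trans (ℕ.*-identityˡ _) (δ-+ˡ p a l)) (trans (ℕ.*-identityˡ _) (δ-+ˡ q b l′)))) ⟩
    anti m (λ l l′ → 1 ℕ.* δ (p ℕ.+ a) (p ℕ.+ l) ℕ.* (1 ℕ.* δ (q ℕ.+ b) (q ℕ.+ l′))) ∎
  weight : ∀ G₁ G₂ → pairWeight (p ℕ.+ q ℕ.+ m) G₁ G₂ ≡ anti m (λ l l′ → f₁ l G₁ ℕ.* f₂ l′ G₂)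
  weight G₁ G₂ with conn G₁ in c₁ | conn G₂ in c₂
  ... | false | _     = sym (anti-0 m)
  ... | true  | false = sym (trans (anti-cong m λ l l′ _ → ℕ.*-zeroʳ (1 ℕ.* δ (suc (edges G₁)) (p ℕ.+ l))) (anti-0 m))
  ... | true  | true  = distribute (conn-excess G₁ c₁) (conn-excess G₂ c₂)

-- The recurrence for the coefficients

splitCount : ℕ → ℕ → ℕ → ℕ
splitCount r s n =
  Σ[ A ∈ subsets r ] Σ[ B ∈ subsets s ] card A ℕ.* (card (∁ B) ℕ.* pairCount (card A) (card B) (card (∁ A)) (card (∁ B)) n)

-- This is r! s! times the coefficient of x^r y^s in the sum of the products `Dx` F_l times `Dy`
-- F_l′ over l + l′ = m; see `products-weight`.
convolution : ℕ → ℕ → ℕ → ℕ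
convolution r s m = anti m λ l l′ → anti r λ i i′ → anti s λ j j′ →
  bin i i′ ℕ.* (bin j j′ ℕ.* (i ℕ.* (j′ ℕ.* (Nbi i j (+ l) ℕ.* Nbi i′ j′ (+ l′)))))

-- After the excess is distributed, the summand depends on A and B only through their sizes, so
-- binomials count the choices.
splitCount≡convolution : ∀ r s m → splitCount r s (r ℕ.+ s ℕ.+ m) ≡ convolution r s m
splitCount≡convolution r s m = begin
  splitCount r s (r ℕ.+ s ℕ.+ m)
    ≡⟨ Sum-cong (subsets r) (λ A → Sum-cong (subsets s) λ B → expand A B) ⟩
  (Σ[ A ∈ subsets r ] Σ[ B ∈ subsets s ] anti m (λ l l′ → term l l′ (card A) (card (∁ A)) (card B) (card (∁ B))))
    ≡⟨ Sum-cong (subsets r) (λ A → Sum-anti (subsets s) m _) ⟩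
  (Σ[ A ∈ subsets r ] anti m (λ l l′ → Σ[ B ∈ subsets s ] term l l′ (card A) (card (∁ A)) (card B) (card (∁ B))))
    ≡⟨ Sum-anti (subsets r) m _ ⟩
  anti m (λ l l′ → Σ[ A ∈ subsets r ] Σ[ B ∈ subsets s ] term l l′ (card A) (card (∁ A)) (card B) (card (∁ B)))
    ≡⟨ anti-cong m (λ l l′ _ → trans
         (Sum-cong (subsets r) λ A → Sum-subsets-card s (term l l′ (card A) (card (∁ A))))
         (Sum-subsets-card r λ i i′ → anti s λ j j′ → bin j j′ ℕ.* term l l′ i i′ j j′)) ⟩
  anti m (λ l l′ → anti r λ i i′ → bin i i′ ℕ.* anti s λ j j′ → bin j j′ ℕ.* term l l′ i i′ j j′)
    ≡⟨ anti-cong m (λ l l′ _ → anti-cong r λ i i′ _ → sym (anti-*ˡ s (bin i i′) _)) ⟩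
  convolution r s m ∎
  where
  term : (l l′ i i′ j j′ : ℕ) → ℕ
  term l l′ i i′ j j′ = i ℕ.* (j′ ℕ.* (Nbi i j (+ l) ℕ.* Nbi i′ j′ (+ l′)))
  expand : ∀ A B → card A ℕ.* (card (∁ B) ℕ.* pairCount (card A) (card B) (card (∁ A)) (card (∁ B)) (r ℕ.+ s ℕ.+ m))
                   ≡ anti m (λ l l′ → term l l′ (card A) (card (∁ A)) (card B) (card (∁ B)))
  expand A B = begin
    card A ℕ.* (card (∁ B) ℕ.* pairCount (card A) (card B) (card (∁ A)) (card (∁ B)) (r ℕ.+ s ℕ.+ m))
      ≡⟨ cong (λ z → card A ℕ.* (card (∁ B) ℕ.* pairCount (card A) (card B) (card (∁ A)) (card (∁ B)) (z ℕ.+ m)))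
           (sym (trans (interchange (card A) (card B) _ _) (cong₂ ℕ._+_ (card-∁ A) (card-∁ B)))) ⟩
    card A ℕ.* (card (∁ B) ℕ.* pairCount (card A) (card B) (card (∁ A)) (card (∁ B)) (card A ℕ.+ card B ℕ.+ (card (∁ A) ℕ.+ card (∁ B)) ℕ.+ m))
      ≡⟨ cong (λ z → card A ℕ.* (card (∁ B) ℕ.* z)) (pairCount-anti (card A) (card B) (card (∁ A)) (card (∁ B)) m) ⟩
    card A ℕ.* (card (∁ B) ℕ.* anti m f)
      ≡⟨ cong (card A ℕ.*_) (sym (anti-*ˡ m (card (∁ B)) f)) ⟩
    card A ℕ.* anti m (λ l l′ → card (∁ B) ℕ.* f l l′)
      ≡⟨ sym (anti-*ˡ m (card A) _) ⟩
    anti m (λ l l′ → card A ℕ.* (card (∁ B) ℕ.* f l l′)) ∎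
    where
    f : ℕ → ℕ → ℕ
    f l l′ = Nbi (card A) (card B) (+ l) ℕ.* Nbi (card (∁ A)) (card (∁ B)) (+ l′)

-- Each of the two graphs contributes at least one to the index. This serves the boundary cases that
-- `edge-count`, which starts at e + 1, does not reach.
splitCount-small : ∀ r s n → n ℕ.≤ 1 → splitCount r s n ≡ 0
splitCount-small r s n n≤1 = Sum-0 (subsets r) λ A → Sum-0 (subsets s) λ B →
  trans (cong (λ z → card A ℕ.* (card (∁ B) ℕ.* z)) (Sum-0 (allBiGraphs (card A) (card B)) λ G₁ → Sum-0 (allBiGraphs (card (∁ A)) (card (∁ B))) λ G₂ →
          trans (cong (χ (conn G₁) ℕ.* χ (conn G₂) ℕ.*_) (δ-small (edges G₁) (edges G₂) n n≤1)) (ℕ.*-zeroʳ (χ (conn G₁) ℕ.* χ (conn G₂)))))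
        (trans (cong (card A ℕ.*_) (ℕ.*-zeroʳ (card (∁ B)))) (ℕ.*-zeroʳ (card A)))
  where
  δ-small : ∀ a b n → n ℕ.≤ 1 → δ (suc a ℕ.+ suc b) n ≡ 0
  δ-small a b zero       _ = refl
  δ-small a b (suc zero) _ = cong (λ z → δ z 0) (ℕ.+-suc a b)
  δ-small a b (suc (suc n)) (s≤s ())

-- For n = e + 1 this is `edge-count`; for n = 0 every term vanishes, so the default `pred 0` = 0
-- does no harm.
connCount-recurrence : ∀ r s n → n ℕ.* connCount r s (suc n) ℕ.+ pred n ℕ.* connCount r s n
                       ≡ r ℕ.* s ℕ.* connCount r s n ℕ.+ splitCount r s (suc n)
connCount-recurrence r s zero    = sym (cong₂ ℕ._+_
  (trans (cong (r ℕ.* s ℕ.*_) (connCount-0 r s)) (ℕ.*-zeroʳ (r ℕ.* s)))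
  (splitCount-small r s 1 ℕ.≤-refl))
connCount-recurrence r s (suc e) = edge-count r s e

-- The factors r + s + m and its predecessor are the numbers of edges of the graphs counted by `Nbi`
-- at m + 1 and at m.
Nbi-recurrence : ∀ r s m → (r ℕ.+ s ℕ.+ m) ℕ.* Nbi r s (+ suc m) ℕ.+ pred (r ℕ.+ s ℕ.+ m) ℕ.* Nbi r s (+ m)
                 ≡ r ℕ.* s ℕ.* Nbi r s (+ m) ℕ.+ convolution r s (suc m)
Nbi-recurrence r s m = begin
  n ℕ.* Nbi r s (+ suc m) ℕ.+ pred n ℕ.* Nbi r s (+ m)
    ≡⟨ cong₂ (λ a b → n ℕ.* a ℕ.+ pred n ℕ.* b)
         (trans (Nbi≡connCount r s (suc m)) (cong (connCount r s) (ℕ.+-suc (r ℕ.+ s) m)))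
         (Nbi≡connCount r s m) ⟩
  n ℕ.* connCount r s (suc n) ℕ.+ pred n ℕ.* connCount r s n
    ≡⟨ connCount-recurrence r s n ⟩
  r ℕ.* s ℕ.* connCount r s n ℕ.+ splitCount r s (suc n)
    ≡⟨ cong₂ (λ a b → r ℕ.* s ℕ.* a ℕ.+ b) (sym (Nbi≡connCount r s m))
         (trans (cong (splitCount r s) (sym (ℕ.+-suc (r ℕ.+ s) m))) (splitCount≡convolution r s (suc m))) ⟩
  r ℕ.* s ℕ.* Nbi r s (+ m) ℕ.+ convolution r s (suc m) ∎
  where n = r ℕ.+ s ℕ.+ m

-- The case k = -1: when r + s = n + 1, the recurrence at n loses both terms with `connCount r s n`,
-- for graphs with so few edges are disconnected.
Nbi-recurrence₀ : ∀ r s → pred (r ℕ.+ s) ℕ.* Nbi r s (+ 0) ≡ convolution r s 0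
Nbi-recurrence₀ r s = begin
  pred (r ℕ.+ s) ℕ.* Nbi r s (+ 0)
    ≡⟨ cong (pred (r ℕ.+ s) ℕ.*_) (trans (Nbi≡connCount r s 0) (cong (connCount r s) (ℕ.+-identityʳ (r ℕ.+ s)))) ⟩
  pred (r ℕ.+ s) ℕ.* connCount r s (r ℕ.+ s)
    ≡⟨ go (r ℕ.+ s) refl ⟩
  splitCount r s (r ℕ.+ s)
    ≡⟨ trans (cong (splitCount r s) (sym (ℕ.+-identityʳ (r ℕ.+ s)))) (splitCount≡convolution r s 0) ⟩
  convolution r s 0 ∎
  where
  go : ∀ n → n ≡ r ℕ.+ s → pred n ℕ.* connCount r s n ≡ splitCount r s n
  go zero    _  = sym (splitCount-small r s 0 z≤n)
  go (suc n) eq = begin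
    n ℕ.* connCount r s (suc n)
      ≡⟨ sym (ℕ.+-identityʳ _) ⟩
    n ℕ.* connCount r s (suc n) ℕ.+ 0
      ≡⟨ cong (n ℕ.* connCount r s (suc n) ℕ.+_) (sym (trans (cong (pred n ℕ.*_) none) (ℕ.*-zeroʳ (pred n)))) ⟩
    n ℕ.* connCount r s (suc n) ℕ.+ pred n ℕ.* connCount r s n
      ≡⟨ connCount-recurrence r s n ⟩
    r ℕ.* s ℕ.* connCount r s n ℕ.+ splitCount r s (suc n)
      ≡⟨ cong (ℕ._+ splitCount r s (suc n)) (trans (cong (r ℕ.* s ℕ.*_) none) (ℕ.*-zeroʳ (r ℕ.* s))) ⟩
    splitCount r s (suc n) ∎
    where
    none = connCount-below r s n eq

Nbi-empty : ∀ r s m → r ℕ.+ s ℕ.+ m ≡ 0 → Nbi r s (+ m) ≡ 0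
Nbi-empty r s m e = trans (Nbi≡connCount r s m) (trans (cong (connCount r s) e) (connCount-0 r s))

-- Generating functions

ι : ℤ → ℚ
ι z = z / 1

toℚᵘ-/ : ∀ a n → ℚ.toℚᵘ (a / suc n) ℚᵘ.≃ ℚᵘ.mkℚᵘ a n
toℚᵘ-/ a n = ℚ.toℚᵘ-fromℚᵘ (ℚᵘ.mkℚᵘ a n)

ι-+ : ∀ a b → ι (a + b) ≡ ι a ℚ.+ ι b
ι-+ a b = ℚ.toℚᵘ-injective (ℚᵘ.≃-trans (toℚᵘ-/ (a + b) 0) (ℚᵘ.≃-trans
  (ℚᵘ.*≡* (cong (ℤ._* 1ℤ) (sym (cong₂ _+_ (ℤ.*-identityʳ a) (ℤ.*-identityʳ b)))))
  (ℚᵘ.≃-sym (ℚᵘ.≃-trans (ℚ.toℚᵘ-homo-+ (ι a) (ι b)) (ℚᵘ.+-cong (toℚᵘ-/ a 0) (toℚᵘ-/ b 0))))))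

ι-* : ∀ a b → ι (a ℤ.* b) ≡ ι a ℚ.* ι b
ι-* a b = ℚ.toℚᵘ-injective (ℚᵘ.≃-trans (toℚᵘ-/ (a ℤ.* b) 0)
  (ℚᵘ.≃-sym (ℚᵘ.≃-trans (ℚ.toℚᵘ-homo-* (ι a) (ι b)) (ℚᵘ.*-cong (toℚᵘ-/ a 0) (toℚᵘ-/ b 0)))))

ι-neg : ∀ a → ι (ℤ.- a) ≡ ℚ.- ι a
ι-neg a = ℚ.toℚᵘ-injective (ℚᵘ.≃-trans (toℚᵘ-/ (ℤ.- a) 0)
  (ℚᵘ.≃-sym (ℚᵘ.≃-trans (ℚ.toℚᵘ-homo‿- (ι a)) (ℚᵘ.-‿cong (toℚᵘ-/ a 0)))))

ιₙ : ℕ → ℚ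
ιₙ n = ι (+ n)

ιₙ-+ : ∀ m n → ιₙ (m ℕ.+ n) ≡ ιₙ m ℚ.+ ιₙ n
ιₙ-+ m n = ι-+ (+ m) (+ n)

ιₙ-* : ∀ m n → ιₙ (m ℕ.* n) ≡ ιₙ m ℚ.* ιₙ n
ιₙ-* m n = trans (cong ι (ℤ.pos-* m n)) (ι-* (+ m) (+ n))

/-*-ι : ∀ a n .{{_ : ℕ.NonZero n}} → (a / n) ℚ.* ιₙ n ≡ ι a
/-*-ι a (suc n) = ℚ.toℚᵘ-injective (ℚᵘ.≃-trans (ℚ.toℚᵘ-homo-* (a / suc n) (ιₙ (suc n)))
  (ℚᵘ.≃-trans (ℚᵘ.*-cong (toℚᵘ-/ a n) (toℚᵘ-/ (+ suc n) 0))
  (ℚᵘ.≃-trans (ℚᵘ.*≡* (trans (ℤ.*-identityʳ _) (cong (λ z → a ℤ.* + suc z) (sym (ℕ.*-identityʳ n)))))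
  (ℚᵘ.≃-sym (toℚᵘ-/ a 0)))))

*-ι-cancelʳ : ∀ n .{{_ : ℕ.NonZero n}} p q → p ℚ.* ιₙ n ≡ q ℚ.* ιₙ n → p ≡ q
*-ι-cancelʳ n p q e = begin
  p                                ≡⟨ unit p ⟩
  p ℚ.* ιₙ n ℚ.* (+ 1 / n)         ≡⟨ cong (ℚ._* (+ 1 / n)) e ⟩
  q ℚ.* ιₙ n ℚ.* (+ 1 / n)         ≡⟨ sym (unit q) ⟩
  q                                ∎
  where
  unit : ∀ p → p ≡ p ℚ.* ιₙ n ℚ.* (+ 1 / n)
  unit p = begin
    p                              ≡⟨ sym (ℚ.*-identityʳ p) ⟩
    p ℚ.* 1ℚ                       ≡⟨ cong (p ℚ.*_) (sym (/-*-ι (+ 1) n)) ⟩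
    p ℚ.* ((+ 1 / n) ℚ.* ιₙ n)     ≡⟨ cong (p ℚ.*_) (ℚ.*-comm (+ 1 / n) (ιₙ n)) ⟩
    p ℚ.* (ιₙ n ℚ.* (+ 1 / n))     ≡⟨ sym (ℚ.*-assoc p _ _) ⟩
    p ℚ.* ιₙ n ℚ.* (+ 1 / n)       ∎

-- Passes from a rational convolution with truncated subtraction to `anti` over ℕ; the common factor
-- c clears the denominators term by term.
sum-anti : ∀ n c (t : ℕ → ℕ → ℚ) (g : ℕ → ℕ → ℕ) →
  (∀ i j → i ℕ.+ j ≡ n → t i j ℚ.* c ≡ ιₙ (g i j)) →
  (∑[ i ≤ n ] t (toℕ i) (n ∸ toℕ i)) ℚ.* c ≡ ιₙ (anti n g)
sum-anti zero    c t g h = trans (cong (ℚ._* c) (ℚ.+-identityʳ (t 0 0))) (h 0 0 refl)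
sum-anti (suc n) c t g h = begin
  (t 0 (suc n) ℚ.+ rest) ℚ.* c
    ≡⟨ ℚ.*-distribʳ-+ c (t 0 (suc n)) rest ⟩
  t 0 (suc n) ℚ.* c ℚ.+ rest ℚ.* c
    ≡⟨ cong₂ ℚ._+_ (h 0 (suc n) refl) (sum-anti n c (t ∘ suc) (g ∘ suc) λ i j e → h (suc i) j (cong suc e)) ⟩
  ιₙ (g 0 (suc n)) ℚ.+ ιₙ (anti n (g ∘ suc))
    ≡⟨ sym (ιₙ-+ (g 0 (suc n)) _) ⟩
  ιₙ (anti (suc n) g) ∎
  where rest = ∑[ i ≤ n ] t (suc (toℕ i)) (n ∸ toℕ i)

-- Coefficients cleared of denominators

Dx-coeff : ∀ f r s → Dx f r s ≡ ιₙ r ℚ.* f r s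
Dx-coeff f zero    s = sym (ℚ.*-zeroˡ (f 0 s))
Dx-coeff f (suc r) s = refl

Dy-coeff : ∀ f r s → Dy f r s ≡ ιₙ s ℚ.* f r s
Dy-coeff f r zero    = sym (ℚ.*-zeroˡ (f r 0))
Dy-coeff f r (suc s) = refl

weight : ℕ → ℕ → ℚ
weight r s = ιₙ (r ! ℕ.* s !)

F-weight : ∀ m r s → F (+ m) r s ℚ.* weight r s ≡ ιₙ (Nbi r s (+ m))
F-weight m r s = /-*-ι (+ Nbi r s (+ m)) (r ! ℕ.* s !) {{r ℕ.!* s !≢0}}

-- The binomials that count the choices of A and B are exactly the mismatch between the denominators
-- of a product of exponential series and those of its factors.
weight-bin : ∀ i i′ j j′ → weight (i ℕ.+ i′) (j ℕ.+ j′)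
             ≡ ιₙ (bin i i′) ℚ.* (ιₙ (bin j j′) ℚ.* (weight i j ℚ.* weight i′ j′))
weight-bin i i′ j j′ = begin
  ιₙ ((i ℕ.+ i′) ! ℕ.* (j ℕ.+ j′) !)
    ≡⟨ cong ιₙ (cong₂ ℕ._*_ (sym (bin-! i i′)) (sym (bin-! j j′))) ⟩
  ιₙ (bin i i′ ℕ.* (i ! ℕ.* i′ !) ℕ.* (bin j j′ ℕ.* (j ! ℕ.* j′ !)))
    ≡⟨ cong ιₙ (solve 6 (λ b c p p′ q q′ → (b :* (p :* p′)) :* (c :* (q :* q′)) := b :* (c :* ((p :* q) :* (p′ :* q′))))
         refl (bin i i′) (bin j j′) (i !) (i′ !) (j !) (j′ !)) ⟩
  ιₙ (bin i i′ ℕ.* (bin j j′ ℕ.* (i ! ℕ.* j ! ℕ.* (i′ ! ℕ.* j′ !))))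
    ≡⟨ trans (ιₙ-* (bin i i′) _) (cong (ιₙ (bin i i′) ℚ.*_) (trans (ιₙ-* (bin j j′) _)
         (cong (ιₙ (bin j j′) ℚ.*_) (ιₙ-* (i ! ℕ.* j !) (i′ ! ℕ.* j′ !))))) ⟩
  ιₙ (bin i i′) ℚ.* (ιₙ (bin j j′) ℚ.* (weight i j ℚ.* weight i′ j′)) ∎
  where open ℕ-Solver.+-*-Solver

product-term : ∀ l l′ i i′ j j′ →
  Dx (F (+ l)) i j ℚ.* Dy (F (+ l′)) i′ j′ ℚ.* weight (i ℕ.+ i′) (j ℕ.+ j′)
    ≡ ιₙ (bin i i′ ℕ.* (bin j j′ ℕ.* (i ℕ.* (j′ ℕ.* (Nbi i j (+ l) ℕ.* Nbi i′ j′ (+ l′))))))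
product-term l l′ i i′ j j′ = begin
  Dx f i j ℚ.* Dy g i′ j′ ℚ.* weight (i ℕ.+ i′) (j ℕ.+ j′)
    ≡⟨ cong₂ ℚ._*_ (cong₂ ℚ._*_ (Dx-coeff f i j) (Dy-coeff g i′ j′)) (weight-bin i i′ j j′) ⟩
  ιₙ i ℚ.* f i j ℚ.* (ιₙ j′ ℚ.* g i′ j′) ℚ.* (b ℚ.* (c ℚ.* (weight i j ℚ.* weight i′ j′)))
    ≡⟨ solve 8 (λ x p y q b c v w → ((x :* p) :* (y :* q)) :* (b :* (c :* (v :* w)))
         := b :* (c :* (x :* (y :* ((p :* v) :* (q :* w)))))) refl
         (ιₙ i) (f i j) (ιₙ j′) (g i′ j′) b c (weight i j) (weight i′ j′) ⟩
  b ℚ.* (c ℚ.* (ιₙ i ℚ.* (ιₙ j′ ℚ.* (f i j ℚ.* weight i j ℚ.* (g i′ j′ ℚ.* weight i′ j′)))))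
    ≡⟨ cong (λ z → b ℚ.* (c ℚ.* (ιₙ i ℚ.* (ιₙ j′ ℚ.* z)))) (cong₂ ℚ._*_ (F-weight l i j) (F-weight l′ i′ j′)) ⟩
  b ℚ.* (c ℚ.* (ιₙ i ℚ.* (ιₙ j′ ℚ.* (ιₙ M ℚ.* ιₙ N))))
    ≡⟨ sym (trans (ιₙ-* (bin i i′) _) (cong (b ℚ.*_) (trans (ιₙ-* (bin j j′) _) (cong (c ℚ.*_)
         (trans (ιₙ-* i _) (cong (ιₙ i ℚ.*_) (trans (ιₙ-* j′ _) (cong (ιₙ j′ ℚ.*_) (ιₙ-* M N))))))))) ⟩
  ιₙ (bin i i′ ℕ.* (bin j j′ ℕ.* (i ℕ.* (j′ ℕ.* (M ℕ.* N))))) ∎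
  where
  open ℚ-Solver.+-*-Solver
  f = F (+ l)
  g = F (+ l′)
  b = ιₙ (bin i i′)
  c = ιₙ (bin j j′)
  M = Nbi i j (+ l)
  N = Nbi i′ j′ (+ l′)

products : ℕ → Series
products m = ∑ₛ (suc m) (λ l → Dx (F (+ toℕ l)) ⊛ Dy (F (+ m - + toℕ l)))

products-weight : ∀ m r s → products m r s ℚ.* weight r s ≡ ιₙ (convolution r s m)
products-weight m r s = trans
  -- The index of the second factor is an integer difference; l ≤ m makes it a natural number, so
  -- that the nonnegative clause of `F` applies.
  (cong (ℚ._* weight r s) (sum-cong-≗ {suc m} λ l →
    cong (λ z → (Dx (F (+ toℕ l)) ⊛ Dy (F z)) r s)
      (trans (ℤ.m-n≡m⊖n m (toℕ l)) (ℤ.⊖-≥ (ℕ.≤-pred (Fin.toℕ<n l))))))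
  (sum-anti m (weight r s) (λ l l′ → (Dx (F (+ l)) ⊛ Dy (F (+ l′))) r s) _ λ l l′ _ →
    sum-anti r (weight r s) (λ i i′ → ∑[ j ≤ s ] (Dx (F (+ l)) i (toℕ j) ℚ.* Dy (F (+ l′)) i′ (s ∸ toℕ j))) _ λ i i′ ei →
      sum-anti s (weight r s) (λ j j′ → Dx (F (+ l)) i j ℚ.* Dy (F (+ l′)) i′ j′) _ λ j j′ ej →
        trans (cong (Dx (F (+ l)) i j ℚ.* Dy (F (+ l′)) i′ j′ ℚ.*_) (cong₂ weight (sym ei) (sym ej)))
              (product-term l l′ i i′ j j′))

-- `Dx` and `Dy` act on each monomial by a scalar, so after multiplication by r! s! the claim is a
-- scalar equation. The series stay generic to cover k = -1 along with k ≥ 0.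
compare-coeff : ∀ k (f g h : Series) r s {a b c} →
  f r s ℚ.* weight r s ≡ a → g r s ℚ.* weight r s ≡ b → h r s ℚ.* weight r s ≡ c →
  (ιₙ r ℚ.+ ιₙ s ℚ.+ ι k) ℚ.* a
    ≡ (ιₙ r ℚ.* ιₙ s ℚ.- ιₙ r ℚ.- ιₙ s ℚ.+ ι (1ℤ - k)) ℚ.* b ℚ.+ c →
  (Dx f ⊕ Dy f ⊕ k • f) r s ≡ ((Dx (Dy g) ⊖ Dx g ⊖ Dy g ⊕ (1ℤ - k) • g) ⊕ h) r s
compare-coeff k f g h r s refl refl refl e =
  *-ι-cancelʳ (r ! ℕ.* s !) {{r ℕ.!* s !≢0}} _ _ (begin
  (Dx f r s ℚ.+ Dy f r s ℚ.+ ι k ℚ.* φ) ℚ.* w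
    ≡⟨ cong (ℚ._* w) (cong₂ (λ p q → p ℚ.+ q ℚ.+ ι k ℚ.* φ) (Dx-coeff f r s) (Dy-coeff f r s)) ⟩
  (x ℚ.* φ ℚ.+ y ℚ.* φ ℚ.+ ι k ℚ.* φ) ℚ.* w
    ≡⟨ solve 5 (λ x y k φ w → (x :* φ :+ y :* φ :+ k :* φ) :* w := (x :+ y :+ k) :* (φ :* w)) refl x y (ι k) φ w ⟩
  (x ℚ.+ y ℚ.+ ι k) ℚ.* (φ ℚ.* w)
    ≡⟨ e ⟩
  (x ℚ.* y ℚ.- x ℚ.- y ℚ.+ ι (1ℤ - k)) ℚ.* (γ ℚ.* w) ℚ.+ η ℚ.* w
    ≡⟨ solve 6 (λ x y k γ η w → (x :* y :- x :- y :+ k) :* (γ :* w) :+ η :* w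
         := ((x :* (y :* γ) :- x :* γ :- y :* γ :+ k :* γ) :+ η) :* w) refl x y (ι (1ℤ - k)) γ η w ⟩
  (x ℚ.* (y ℚ.* γ) ℚ.- x ℚ.* γ ℚ.- y ℚ.* γ ℚ.+ ι (1ℤ - k) ℚ.* γ ℚ.+ η) ℚ.* w
    ≡⟨ cong (λ z → (z ℚ.+ ι (1ℤ - k) ℚ.* γ ℚ.+ η) ℚ.* w) (sym (cong₂ ℚ._-_
         (cong₂ ℚ._-_ (trans (Dx-coeff (Dy g) r s) (cong (x ℚ.*_) (Dy-coeff g r s))) (Dx-coeff g r s))
         (Dy-coeff g r s))) ⟩
  (Dx (Dy g) r s ℚ.- Dx g r s ℚ.- Dy g r s ℚ.+ ι (1ℤ - k) ℚ.* γ ℚ.+ η) ℚ.* w ∎)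
  where
  open ℚ-Solver.+-*-Solver
  x = ιₙ r
  y = ιₙ s
  w = weight r s
  φ = f r s
  γ = g r s
  η = h r s

-- Truncated and true predecessor differ only at n = 0, where a = 0 hides it.
ιₙ-pred : ∀ n a → (n ≡ 0 → a ≡ 0) → ιₙ (pred n ℕ.* a) ≡ (ιₙ n ℚ.- 1ℚ) ℚ.* ιₙ a
ιₙ-pred zero    a h rewrite h refl = refl
ιₙ-pred (suc n) a h = trans (ιₙ-* n a) (cong (ℚ._* ιₙ a) (begin
  ιₙ n
    ≡⟨ solve 2 (λ x u → x := (u :+ x) :- u) refl (ιₙ n) 1ℚ ⟩
  (1ℚ ℚ.+ ιₙ n) ℚ.- 1ℚ
    ≡⟨ cong (ℚ._- 1ℚ) (sym (ιₙ-+ 1 n)) ⟩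
  ιₙ (suc n) ℚ.- 1ℚ ∎))
  where open ℚ-Solver.+-*-Solver

-- The operator on F_k comes from r s - (r + s + k - 1), the number of non-edges: `ν` is the number
-- of edges of the graphs counted by `N`.
coefficient-identity : ∀ r s k →
  (ιₙ r ℚ.+ ιₙ s ℚ.+ ιₙ k) ℚ.* ιₙ (Nbi r s (+ suc k))
    ≡ (ιₙ r ℚ.* ιₙ s ℚ.- ιₙ r ℚ.- ιₙ s ℚ.+ ι (1ℤ - + k)) ℚ.* ιₙ (Nbi r s (+ k)) ℚ.+ ιₙ (convolution r s (suc k))
coefficient-identity r s k = begin
  (x ℚ.+ y ℚ.+ z) ℚ.* ιₙ M
    -- `ν` times `N` is added and subtracted, since the recurrence over ℕ has this term on its left
    -- side.
    ≡⟨ solve 5 (λ x y z u M → (x :+ y :+ z) :* M := (x :+ y :+ z) :* M :+ u :- u) refl x y z (ν ℚ.* ιₙ N) (ιₙ M) ⟩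
  (x ℚ.+ y ℚ.+ z) ℚ.* ιₙ M ℚ.+ ν ℚ.* ιₙ N ℚ.- ν ℚ.* ιₙ N
    ≡⟨ cong (ℚ._- ν ℚ.* ιₙ N) recurrence ⟩
  x ℚ.* y ℚ.* ιₙ N ℚ.+ ιₙ C ℚ.- ν ℚ.* ιₙ N
    ≡⟨ solve 6 (λ x y z u N C → ((x :* y) :* N :+ C) :- ((x :+ y :+ z) :- u) :* N
         := (x :* y :- x :- y :+ (u :- z)) :* N :+ C) refl x y z 1ℚ (ιₙ N) (ιₙ C) ⟩
  (x ℚ.* y ℚ.- x ℚ.- y ℚ.+ (1ℚ ℚ.- z)) ℚ.* ιₙ N ℚ.+ ιₙ C
    ≡⟨ cong (λ t → (x ℚ.* y ℚ.- x ℚ.- y ℚ.+ t) ℚ.* ιₙ N ℚ.+ ιₙ C)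
         (sym (trans (ι-+ 1ℤ (ℤ.- + k)) (cong (1ℚ ℚ.+_) (ι-neg (+ k))))) ⟩
  (x ℚ.* y ℚ.- x ℚ.- y ℚ.+ ι (1ℤ - + k)) ℚ.* ιₙ N ℚ.+ ιₙ C ∎
  where
  open ℚ-Solver.+-*-Solver
  x = ιₙ r
  y = ιₙ s
  z = ιₙ k
  n = r ℕ.+ s ℕ.+ k
  M = Nbi r s (+ suc k)
  N = Nbi r s (+ k)
  C = convolution r s (suc k)
  ν = x ℚ.+ y ℚ.+ z ℚ.- 1ℚ
  ι-n : ιₙ n ≡ x ℚ.+ y ℚ.+ z
  ι-n = trans (ιₙ-+ (r ℕ.+ s) k) (cong (ℚ._+ z) (ιₙ-+ r s))
  recurrence : (x ℚ.+ y ℚ.+ z) ℚ.* ιₙ M ℚ.+ ν ℚ.* ιₙ N ≡ x ℚ.* y ℚ.* ιₙ N ℚ.+ ιₙ C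
  recurrence = begin
    (x ℚ.+ y ℚ.+ z) ℚ.* ιₙ M ℚ.+ ν ℚ.* ιₙ N
      ≡⟨ cong (λ t → t ℚ.* ιₙ M ℚ.+ (t ℚ.- 1ℚ) ℚ.* ιₙ N) (sym ι-n) ⟩
    ιₙ n ℚ.* ιₙ M ℚ.+ (ιₙ n ℚ.- 1ℚ) ℚ.* ιₙ N
      ≡⟨ sym (trans (ιₙ-+ (n ℕ.* M) _) (cong₂ ℚ._+_ (ιₙ-* n M) (ιₙ-pred n N (Nbi-empty r s k)))) ⟩
    ιₙ (n ℕ.* M ℕ.+ pred n ℕ.* N)
      ≡⟨ cong ιₙ (Nbi-recurrence r s k) ⟩
    ιₙ (r ℕ.* s ℕ.* N ℕ.+ C)
      ≡⟨ trans (ιₙ-+ (r ℕ.* s ℕ.* N) C) (cong (ℚ._+ ιₙ C)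
           (trans (ιₙ-* (r ℕ.* s) N) (cong (ℚ._* ιₙ N) (ιₙ-* r s)))) ⟩
    x ℚ.* y ℚ.* ιₙ N ℚ.+ ιₙ C ∎

coefficient-identity₀ : ∀ r s q →
  (ιₙ r ℚ.+ ιₙ s ℚ.+ ι -1ℤ) ℚ.* ιₙ (Nbi r s (+ 0)) ≡ q ℚ.* 0ℚ ℚ.+ ιₙ (convolution r s 0)
coefficient-identity₀ r s q = begin
  (ιₙ r ℚ.+ ιₙ s ℚ.- 1ℚ) ℚ.* ιₙ N
    ≡⟨ cong (λ t → (t ℚ.- 1ℚ) ℚ.* ιₙ N) (sym (ιₙ-+ r s)) ⟩
  (ιₙ (r ℕ.+ s) ℚ.- 1ℚ) ℚ.* ιₙ N
    ≡⟨ sym (ιₙ-pred (r ℕ.+ s) N λ e → Nbi-empty r s 0 (trans (ℕ.+-identityʳ (r ℕ.+ s)) e)) ⟩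
  ιₙ (pred (r ℕ.+ s) ℕ.* N)
    ≡⟨ cong ιₙ (Nbi-recurrence₀ r s) ⟩
  ιₙ (convolution r s 0)
    ≡⟨ sym (trans (cong (ℚ._+ ιₙ (convolution r s 0)) (ℚ.*-zeroʳ q)) (ℚ.+-identityˡ _)) ⟩
  q ℚ.* 0ℚ ℚ.+ ιₙ (convolution r s 0) ∎
  where N = Nbi r s (+ 0)

-- The successor is a separate argument, because + k + 1 reduces to + (k + 1) and must be
-- transported to + suc k at all its occurrences.
Recurrence : ℤ → ℤ → Set
Recurrence k k+1 =
  Dx (F k+1) ⊕ Dy (F k+1) ⊕ k • F k+1
    ≈ (Dx (Dy (F k)) ⊖ Dx (F k) ⊖ Dy (F k) ⊕ (1ℤ - k) • F k)
      ⊕ ∑ₛ (suc ∣ k+1 ∣) (λ l → Dx (F (+ toℕ l)) ⊛ Dy (F (k+1 - (+ toℕ l))))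

proposition2p2 : (k : ℤ) → -1ℤ ≤ k →
    Dx (F (k + 1ℤ)) ⊕ Dy (F (k + 1ℤ)) ⊕ k • F (k + 1ℤ)
    ≈ (Dx (Dy (F k)) ⊖ Dx (F k) ⊖ Dy (F k) ⊕ (1ℤ - k) • F k)
    ⊕ ∑ₛ (suc ∣ k + 1ℤ ∣) (λ l → Dx (F (+ toℕ l)) ⊛ Dy (F ((k + 1ℤ) - (+ toℕ l))))
proposition2p2 (+ k) _ = subst (Recurrence (+ k)) (cong +_ (ℕ.+-comm 1 k)) λ r s →
  compare-coeff (+ k) (F (+ suc k)) (F (+ k)) (products (suc k)) r s
    (F-weight (suc k) r s) (F-weight k r s) (products-weight (suc k) r s) (coefficient-identity r s k)
proposition2p2 -[1+ zero ] _ r s =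
  compare-coeff -1ℤ (F (+ 0)) 0ₛ (products 0) r s
    (F-weight 0 r s) (ℚ.*-zeroˡ (weight r s)) (products-weight 0 r s) (coefficient-identity₀ r s (ιₙ r ℚ.* ιₙ s ℚ.- ιₙ r ℚ.- ιₙ s ℚ.+ ι (1ℤ - -1ℤ)))
proposition2p2 -[1+ suc _ ] (ℤ.-≤- ())
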